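{- For any locally adaptive randomized protocol $\mathcal{P}$ for Geocast such that uninformed nodes never transmit, any $V_{\max}>0$, any $d>r$ (where $r>0$ is the range of transmission and $d$ is the Geocast eccentricity), any integers $\alpha\ge 0$, $\beta>0$, and any positive integer $k$ such that $\left(\frac{2}{1-1/e}\right)^{\xi/e}<k<n$, where $\xi=2/(1-1/e)^2$, there exists an $(\alpha,\beta)$-connected MANET formed by a set $V$ of $n$ nodes (with node speeds bounded by $V_{\max}$) such that, if $\beta<\dfrac{k}{2e\Gamma}$, where $\Gamma=\xi\ln\delta$ and $\delta=\beta^2k^{e/\xi}$, then, within $\beta$ steps after $k$ nodes were covered, in expectation no new node is covered, even if all nodes were activated simultaneously and do not fail.
   Context: **Model.** A MANET is a set $V$ of $n$ nodes in $\mathbb{R}^2$, no two at the same point at the same time. Time is divided into slots $1,2,\dots$; the topology changes only at slot boundaries, and no node moves faster than $V_{\max}$. All nodes have the same range of transmission $r>0$; two nodes are neighbors in a slot if their distance is at most $r$ during the whole slot. An active node $u$ receives a transmission from a neighbor $v$ in a slot if and only if $v$ is the only node transmitting in that slot among $u$ and its neighbors. There is no collision detection. Nodes may be activated at any slot boundary, and may fail (become inactive) and be reactivated; upon activation a node starts its algorithm from scratch, keeping no state. Slots counted from a node's activation are its (local) steps. **Geocast.** A source node $s$ holds a piece of information $I$ at time $t_1$. $I$ must be delivered to all nodes that at time $t_1$ are active and located within distance $d$ (the eccentricity) of the position of $s$ at that time. A node is covered if it has received $I$ (the source, which holds $I$, counts as covered), otherwise uncovered. A node is informed at time $t$ if it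 holds $I$ at time $t$, otherwise uninformed. The problem is solved at slot $t_2\ge t_1$ if all target nodes are covered by slot $t_2$. **$(\alpha,\beta)$-connectivity** (integers $\alpha\ge0$, $\beta\ge1$). For every slot $t\ge t_1$ at which the problem is not yet solved there is a slot $t'$ such that $[t,t+\alpha]\cap[t',t'+\beta)\neq\emptyset$, and there are nodes $p,p'$ such that at time $t'$ $p$ is informed and $p'$ is uncovered, and $p,p'$ are active and neighbors from step $t'$ until $p'$ becomes covered or until step $t'+\beta-1$ (inclusive), whichever occurs first. **Adversary.** Node movement and activation schedules are controlled by an adaptive adversary, which decides at the end of each slot with access to all nodes' internal states but not to future random bits, subject to the speed bound and $(\alpha,\beta)$-connectivity. "There exists an $(\alpha,\beta)$-connected MANET" refers to a configuration and movement of nodes produced by such an adversary. Expectation is over the protocol's random bits. **Protocols.** Let $s(i,t)\in\{T,R\}^t$ be the transmission/reception schedule of node $i$ in its first $t$ steps. A randomized protocol is locally adaptive if it can be modeled by a set $\{\pi_i : i\in V\}$ of transmission-probability functions such that a covered node $i$ transmits with probability $\pi_i(t,s(i,t-1))$ in the $t$-th step after its activation (no information from other nodes or the channel is used, and the random choices of different nodes are independent). -}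

module Defs where

open import Algebra.Bundles using (CommutativeRing; Semiring)
import Algebra.Definitions.RawSemiring as RawSemiringDefs
open import Axiom.ExcludedMiddle using (ExcludedMiddle)
open import Data.Bool.Base using (Bool; true; false; if_then_else_; _∧_; _∨_)
open import Data.Fin.Base using (Fin; toℕ)
open import Data.Fin.Properties using () renaming (_≟_ to _≟ᶠ_)
open import Data.Fin.Subset using (Subset; _∈_; _∉_; ∣_∣; _─_)
open import Data.Nat.Base as ℕ using (ℕ; zero; suc)
open import Data.Nat.Properties using () renaming (_≟_ to _≟ⁿ_)
open import Data.Product.Base using (Σ; ∃; _×_; _,_)
open import Data.Unit.Base using (⊤)
open import Data.Vec.Base using (Vec; []; _∷_; lookup; tabulate)
open import Function.Bundles using (_⇔_)
open import Level using (0ℓ) renaming (suc to lsuc)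
open import Relation.Binary.Core using (Rel)
open import Relation.Binary.PropositionalEquality using (_≡_; _≢_)
open import Relation.Binary.Structures using (IsTotalOrder)
import Relation.Binary.Construct.NonStrictToStrict as ToStrict
open import Relation.Nullary using (¬_)
open import Relation.Nullary.Decidable using (does)

-- The real numbers: a Cauchy-complete Archimedean ordered field, which
-- determines ℝ up to isomorphism.  The operations √, exp and ln are pinned
-- down by their specifications; like _⁻¹ at 0#, √ and ln are unconstrained
-- outside their usual domains.

record Reals : Set (lsuc 0ℓ) where
  infix  4 _≤_
  infix  8 _⁻¹
  infixl 7 _/_
  infix  4 _⟶_

  field
    commutativeRing : CommutativeRing 0ℓ 0ℓ

  open CommutativeRing commutativeRing public renaming (Carrier to ℝ)
  open RawSemiringDefs (Semiring.rawSemiring semiring) public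
    using (_^_; sum; product) renaming (_×_ to _·_)

  field
    _≤_          : Rel ℝ 0ℓ
    isTotalOrder : IsTotalOrder _≈_ _≤_
    +-monoˡ-≤    : ∀ z {x y} → x ≤ y → x + z ≤ y + z
    *-nonneg     : ∀ {x y} → 0# ≤ x → 0# ≤ y → 0# ≤ x * y
    0≉1          : ¬ (0# ≈ 1#)
    _⁻¹          : ℝ → ℝ
    *-inverseʳ   : ∀ {x} → ¬ (x ≈ 0#) → x * x ⁻¹ ≈ 1#

  open ToStrict _≈_ _≤_ public using (_<_)

  _/_ : ℝ → ℝ → ℝ
  x / y = x * y ⁻¹

  fromℕ : ℕ → ℝ
  fromℕ n = n · 1#

  ∣_-_∣≤_ : ℝ → ℝ → ℝ → Set
  ∣ x - y ∣≤ ε = (- ε ≤ x - y) × (x - y ≤ ε)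

  _⟶_ : (ℕ → ℝ) → ℝ → Set
  s ⟶ l = ∀ ε → 0# < ε → ∃ λ N → ∀ m → N ℕ.≤ m → ∣ s m - l ∣≤ ε

  Cauchy : (ℕ → ℝ) → Set
  Cauchy s = ∀ ε → 0# < ε → ∃ λ N →
             ∀ m m′ → N ℕ.≤ m → N ℕ.≤ m′ → ∣ s m - s m′ ∣≤ ε

  expSeries : ℝ → ℕ → ℝ
  expSeries x m = sum {m} λ j → x ^ toℕ j / fromℕ (toℕ j ℕ.!)

  field
    archimedean : ∀ x → ∃ λ n → x ≤ fromℕ n
    complete    : ∀ s → Cauchy s → ∃ λ l → s ⟶ l

    √           : ℝ → ℝ
    √-nonneg    : ∀ {x} → 0# ≤ x → 0# ≤ √ x
    √-square    : ∀ {x} → 0# ≤ x → √ x * √ x ≈ x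

    exp         : ℝ → ℝ
    exp-series  : ∀ x → expSeries x ⟶ exp x

    ln          : ℝ → ℝ
    exp-ln      : ∀ {x} → 0# < x → exp (ln x) ≈ x

  pow : ℝ → ℝ → ℝ
  pow x y = exp (y * ln x)

  e : ℝ
  e = exp 1#

  ξ : ℝ
  ξ = fromℕ 2 / (1# - 1# / e) ^ 2

  δ : ℕ → ℕ → ℝ
  δ β k = fromℕ β ^ 2 * pow (fromℕ k) (e / ξ)

  Γ : ℕ → ℕ → ℝ
  Γ β k = ξ * ln (δ β k)

data Action : Set where
  T R : Action

-- Excluded middle is used to decide whether a node receives in a slot, which
-- depends on distances between real points at all times of the slot.

module Geocast (em : ExcludedMiddle 0ℓ) (ℛ : Reals) where

  open Reals ℛ

  Point : Set
  Point = ℝ × ℝ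

  infix 4 _≈ₚ_
  _≈ₚ_ : Point → Point → Set
  (x , y) ≈ₚ (x′ , y′) = (x ≈ x′) × (y ≈ y′)

  dist : Point → Point → ℝ
  dist (x , y) (x′ , y′) = √ ((x - x′) ^ 2 + (y - y′) ^ 2)

  -- A randomized locally adaptive protocol.  π i s is the probability that
  -- node i, if informed, transmits in its (m+1)-st local step after the
  -- schedule s of its first m steps, listed most recent step first.

  record Protocol (n : ℕ) : Set where
    field
      π      : Fin n → ∀ {m} → Vec Action m → ℝ
      π-prob : ∀ i {m} (s : Vec Action m) → (0# ≤ π i s) × (π i s ≤ 1#)

  -- Slots are numbered from 0, so that slot m is preceded by m slots.  A
  -- history lists the sets of transmitting nodes of these m slots, most
  -- recent first; given the adversary's strategy it determines the internal
  -- states of all the nodes.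

  History : ℕ → ℕ → Set
  History n m = Vec (Subset n) m

  -- A MANET is an adaptive strategy: for every history of length m it fixes
  -- the active nodes and the motion in slot m.  Within a slot, time runs over
  -- the offsets in [0,1]; offset 1 of a slot is offset 0 of the next one.

  record MANET (n : ℕ) (Vmax : ℝ) : Set where
    field
      source   : Fin n
      t₁       : ℕ
      active   : ∀ {m} → History n m → Subset n
      position : ∀ {m} → History n m → Fin n → ℝ → Point

      source-active : ∀ (h : History n t₁) → source ∈ active h

      distinct   : ∀ {m} (h : History n m) {i j} → i ≢ j →
                   ∀ u → 0# ≤ u → u ≤ 1# →
                   ¬ (position h i u ≈ₚ position h j u)
      speed      : ∀ {m} (h : History n m) i u v → 0# ≤ u → u ≤ v → v ≤ 1# →
                   dist (position h i u) (position h i v) ≤ Vmax * (v - u)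
      continuous : ∀ {m} (h : History n m) (τ : Subset n) i →
                   position h i 1# ≈ₚ position (τ ∷ h) i 0#

  -- The schedule of a running node starts at its latest activation; the flag
  -- says whether the node is informed.

  data Node : Set where
    inactive : Node
    running  : ∀ {m} → Vec Action m → Bool → Node

  informedᵇ : Node → Bool
  informedᵇ inactive      = false
  informedᵇ (running _ b) = b

  switch : Bool → Node → Node
  switch false _             = inactive
  switch true  inactive      = running [] false
  switch true  (running s b) = running s b

  inform : Node → Node
  inform inactive      = inactive
  inform (running s _) = running s true

  step : (transmits receives : Bool) → Node → Node
  step _ _ inactive      = inactive
  step x y (running s b) = running ((if x then T else R) ∷ s) (b ∨ y)

  Σ-subsets : ∀ n → (Subset n → ℝ) → ℝ
  Σ-subsets zero    f = f []
  Σ-subsets (suc n) f = Σ-subsets n (λ τ → f (true ∷ τ)) +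
                        Σ-subsets n (λ τ → f (false ∷ τ))

  prefix : ∀ {n} → (ℕ → Subset n) → ∀ m → History n m
  prefix ω zero    = []
  prefix ω (suc m) = ω m ∷ prefix ω m

  module Execution {n : ℕ} {Vmax : ℝ} (P : Protocol n) (r d : ℝ)
                   (M : MANET n Vmax) where

    open Protocol P
    open MANET M

    -- i and j are neighbors in the slot following h.
    Neighbors : ∀ {m} → History n m → Fin n → Fin n → Set
    Neighbors h i j = i ≢ j × (∀ u → 0# ≤ u → u ≤ 1# →
                               dist (position h i u) (position h j u) ≤ r)

    -- i receives in the slot following h if τ is the set of transmitters.
    Receives : ∀ {m} → History n m → Subset n → Fin n → Set
    Receives h τ i =
      i ∈ active h × i ∉ τ ×
      ∃ λ j → Neighbors h i j × j ∈ τ ×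
              (∀ j′ → Neighbors h i j′ → j′ ∈ τ → j′ ≡ j)

    receivesᵇ : ∀ {m} → History n m → Subset n → Fin n → Bool
    receivesᵇ h τ i = does (em {P = Receives h τ i})

    -- At the start of slot t₁ the source is given the information.
    isStartᵇ : ℕ → Fin n → Bool
    isStartᵇ m i = does (m ≟ⁿ t₁) ∧ does (i ≟ᶠ source)

    -- nodeEnd is the state at the end of the last slot of the history, and
    -- node the state at the start of the next slot, after (de)activations.
    mutual
      nodeEnd : ∀ {m} → History n m → Fin n → Node
      nodeEnd []      i = inactive
      nodeEnd (τ ∷ h) i = step (lookup τ i) (receivesᵇ h τ i) (node h i)

      node : ∀ {m} → History n m → Fin n → Node
      node {m} h i =
        let a = switch (lookup (active h) i) (nodeEnd h i)
        in  if isStartᵇ m i then inform a else a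

    -- Unlike being informed, being covered survives failures.
    mutual
      coveredEndᵇ : ∀ {m} → History n m → Fin n → Bool
      coveredEndᵇ []      i = false
      coveredEndᵇ (τ ∷ h) i = coveredᵇ h i ∨ receivesᵇ h τ i

      coveredᵇ : ∀ {m} → History n m → Fin n → Bool
      coveredᵇ {m} h i = isStartᵇ m i ∨ coveredEndᵇ h i

    covered : ∀ {m} → History n m → Subset n
    covered h = tabulate (coveredᵇ h)

    informed : ∀ {m} → History n m → Subset n
    informed h = tabulate (λ i → informedᵇ (node h i))

    -- Uninformed (in particular inactive) nodes never transmit.
    transmitProb : Fin n → Node → ℝ
    transmitProb i inactive          = 0#
    transmitProb i (running s false) = 0#
    transmitProb i (running s true)  = π i s

    -- Probability, given h, that τ is the set of transmitters of the next slot.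
    slotProb : ∀ {m} → History n m → Subset n → ℝ
    slotProb h τ = product {n} λ i →
      let p = transmitProb i (node h i)
      in  if lookup τ i then p else 1# - p

    -- Conditional expectation, given h, of X at the end of the next b slots.
    𝔼 : ℕ → ∀ {m} → History n m → (∀ {m′} → History n m′ → ℝ) → ℝ
    𝔼 zero    h X = X h
    𝔼 (suc b) h X = Σ-subsets n λ τ → slotProb h τ * 𝔼 b (τ ∷ h) X

    Possible : ∀ {m} → History n m → Set
    Possible []      = ⊤
    Possible (τ ∷ h) = 0# < slotProb h τ × Possible h

    Run : Set
    Run = Σ (ℕ → Subset n) λ ω → ∀ m → Possible (prefix ω m)

    at : Run → ∀ m → History n m
    at (ω , _) = prefix ω

    Target : Run → Fin n → Set
    Target ω i = i ∈ active (at ω t₁) ×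
                 dist (position (at ω t₁) i 0#) (position (at ω t₁) source 0#) ≤ d

    Solved : Run → ℕ → Set
    Solved ω t = ∀ i → Target ω i → i ∈ covered (at ω t)

    -- The witness t″ lies in [t,t+α] ∩ [t′,t′+β).  The pair must be linked in
    -- the slots of [t′,t′+β) at whose start p′ is still uncovered.
    Connected : (α β : ℕ) → Set
    Connected α β =
      ∀ (ω : Run) t → t₁ ℕ.≤ t → ¬ Solved ω t →
      ∃ λ t′ →
        (∃ λ t″ → (t ℕ.≤ t″ × t″ ℕ.≤ t ℕ.+ α) ×
                  (t′ ℕ.≤ t″ × t″ ℕ.< t′ ℕ.+ β)) ×
        (∃ λ p → ∃ λ p′ →
           p ∈ informed (at ω t′) × p′ ∉ covered (at ω t′) ×
           (∀ u → t′ ℕ.≤ u → u ℕ.< t′ ℕ.+ β → p′ ∉ covered (at ω u) →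
              p ∈ active (at ω u) × p′ ∈ active (at ω u) ×
              Neighbors (at ω u) p p′))

    AllTargets : Set
    AllTargets = ∀ ω i → Target ω i

    -- All the nodes are activated at the start of slot a and never fail.
    SimultaneousNoFailures : Set
    SimultaneousNoFailures =
      ∃ λ a → ∀ {m} (h : History n m) i → (i ∈ active h) ⇔ (a ℕ.≤ m)

    newlyCovered : ∀ {m m′} → History n m → History n m′ → ℝ
    newlyCovered h h′ = fromℕ ∣ covered h′ ─ covered h ∣

    -- Whenever at least k nodes have been covered for the first time, exactly
    -- k nodes have been covered (so that, with k < n, the situation "k nodes
    -- are covered" is not bypassed), and the expected number of nodes newly
    -- covered in the next β slots is below one.
    NoProgress : (k β : ℕ) → Set
    NoProgress k β =
      ∀ {m} (h : History n m) (τ : Subset n) → Possible (τ ∷ h) →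
      ∣ covered h ∣ ℕ.< k → k ℕ.≤ ∣ covered (τ ∷ h) ∣ →
      ∣ covered (τ ∷ h) ∣ ≡ k ×
      𝔼 β (τ ∷ h) (newlyCovered (τ ∷ h)) < 1#

{-# OPTIONS --safe #-}
module Submission where

-- The adversary keeps the nodes 0, …, k-1 (the core) in mutual range, node k
-- (the target) just at the border of their range, and all other nodes at first
-- out of range of both.  Every node has a fixed home, and a link is cut by a
-- short excursion within the slot, so that Vmax does not matter.
--
-- Once the core is covered, the target stays linked to one core node u for β
-- slots.  This link witnesses connectivity in all of these slots, even after
-- the target is covered, so that nobody else need be reachable before they are
-- over.  In a heavy slot, in which the transmission probabilities of the core
-- sum to θ = 2 ln δ or more, all of the core is linked to the target, and
-- the number N of transmitters in it is 1 with probability at most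
-- 2 E[2^-N] ≤ 2 exp(-θ/2) = 2/δ.  In a light slot only u is linked to it.  The
-- expected number of transmissions of the core in light slots is at most β θ,
-- and it depends on nothing but the core, so that some u accounts for at most
-- β θ / k.  Hence the target is covered with probability at most
-- 2 β/δ + β θ/k < 1.
open import Defs
open import Algebra.Bundles using (RawRing)
import Algebra.Properties.Ring as RingProperties
import Algebra.Properties.Semiring.Mult as Mult
import Algebra.Properties.Semiring.Mult.TCOptimised as TCOptimised
import Algebra.Properties.Semiring.Sum as SemiringSum
import Algebra.Solver.Ring as RingSolver
open import Algebra.Solver.Ring.AlmostCommutativeRing
  using (fromCommutativeRing; _-Raw-AlmostCommutative⟶_)
open import Axiom.ExcludedMiddle using (ExcludedMiddle)
open import Data.Bool.Base using (Bool; true; false; if_then_else_; _∨_) renaming (T to Truth)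
open import Data.Bool.Properties using (∨-identityʳ)
open import Data.Empty using (⊥-elim)
open import Data.Fin.Base as Fin using (Fin; toℕ; fromℕ<)
open import Data.Fin.Properties using (toℕ-injective; toℕ<n; toℕ-fromℕ<)
  renaming (_≟_ to _≟ᶠ_; suc-injective to suc-injectiveᶠ)
open import Data.Fin.Subset using (Subset; _∈_; _∉_; ⊤; ⊥; ⁅_⁆; ∣_∣; _─_; _⊆_)
open import Data.Fin.Subset.Properties
  using (∈⊤; p⊆q⇒∣p∣≤∣q∣; p⊂q⇒∣p∣<∣q∣; ∣⁅x⁆∣≡1; ∣⊥∣≡0; x∈⁅x⁆; p─q⊆p)
open import Data.Integer.Base as ℤ using (ℤ; +_; -[1+_])
import Data.Integer.Properties as ℤₚ
open import Data.Maybe.Base using (Maybe; just; nothing)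
open import Data.Nat.Base as ℕ using (ℕ; zero; suc)
import Data.Nat.Properties as ℕₚ
open import Data.Product.Base using (Σ; ∃; _×_; _,_; proj₁; proj₂)
open import Data.Sum.Base using (_⊎_; inj₁; inj₂)
open import Data.Vec.Base using (Vec; []; _∷_; lookup; tabulate; here; there)
open import Data.Vec.Properties using (lookup∘tabulate; lookup-replicate; []=⇒lookup; lookup⇒[]=)
open import Function.Base using (_∘_)
open import Function.Bundles using (mk⇔)
open import Level using (0ℓ)
open import Relation.Binary using (Tri; tri<; tri≈; tri>)
open import Relation.Binary.Bundles using (Poset)
open import Relation.Binary.PropositionalEquality as ≡ using (_≡_; _≢_)
import Relation.Binary.Reasoning.PartialOrder as PartialOrderReasoning
import Relation.Binary.Reasoning.Setoid as SetoidReasoning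
open import Relation.Binary.Structures using (IsTotalOrder)
open import Relation.Nullary using (¬_; contradiction; Dec; yes; no)
open import Relation.Nullary.Decidable using (does; dec-true; dec-false)

-- Choosing `u` looks circular: `u` shapes the links of the window, and the links decide what
-- happens in it. But a node's transmission probability depends only on its own schedule, so until
-- the target is covered the transmissions follow a law of the core alone, whatever the links are.
-- Heaviness and the cost of each core node are computed from that law, and `u` is fixed before the
-- window opens. Nothing has to be computed once the target is covered: the whole window never gains
-- more than 1. The final 1 is split as (1 - 1/e) + 1/e. The lower bound on k says that k^(e/ξ) is
-- at least 2/(1 - 1/e), whence 2 β/δ ≤ 1 - 1/e. The upper bound on β, with ξ ≥ 1, gives β θ/k <
-- 1/e. On the analytic side, `exp` is known by its power series and `ln` by `exp (ln x) ≈ x`.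
-- Products of factors 1 - p are therefore compared with partial sums of the series. That ln δ is
-- positive comes from exp x ≤ 1 for x ≤ 0, where the terms alternate in sign; the Cauchy product
-- with the series of exp (- x) controls them.

-- Ordered field arithmetic, with a ring solver over integer coefficients.

module RealArithmetic (ℛ : Reals) where

  open Reals ℛ hiding (zero)
  open RingProperties ring using (-‿distribˡ-*; -‿distribʳ-*; -‿involutive; -0#≈0#; -‿+-comm)
  open TCOptimised semiring using (×-homo-+; ×1-homo-*) renaming (_×_ to _×′_)

  private
    -- The solver has to compare coefficients, and equality is decidable in ℤ but not in ℝ. With the
    -- optimised multiple `_×′_`, the coefficients 0 and 1 evaluate to `0#` and `1#` on the nose.
    ⟦_⟧ : ℤ → ℝ
    ⟦ + n ⟧      = n ×′ 1#
    ⟦ -[1+ n ] ⟧ = - (suc n ×′ 1#)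

    ⊖-homo : ∀ m n → ⟦ m ℤ.⊖ n ⟧ ≈ (m ×′ 1#) - (n ×′ 1#)
    ⊖-homo m       zero    = sym (trans (+-congˡ -0#≈0#) (+-identityʳ _))
    ⊖-homo zero    (suc n) = sym (+-identityˡ _)
    ⊖-homo (suc m) (suc n) = begin
      ⟦ suc m ℤ.⊖ suc n ⟧                           ≡⟨ ≡.cong ⟦_⟧ (ℤₚ.[1+m]⊖[1+n]≡m⊖n m n) ⟩
      ⟦ m ℤ.⊖ n ⟧                                   ≈⟨ ⊖-homo m n ⟩
      M - N                                         ≈⟨ +-identityˡ _ ⟨
      0# + (M - N)                                  ≈⟨ +-congʳ (-‿inverseʳ 1#) ⟨
      (1# - 1#) + (M - N)                           ≈⟨ +-assoc _ _ _ ⟩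
      1# + (- 1# + (M - N))                         ≈⟨ +-congˡ (+-assoc _ _ _) ⟨
      1# + ((- 1# + M) - N)                         ≈⟨ +-congˡ (+-congʳ (+-comm _ _)) ⟩
      1# + ((M - 1#) - N)                           ≈⟨ +-congˡ (+-assoc _ _ _) ⟩
      1# + (M + (- 1# - N))                         ≈⟨ +-assoc _ _ _ ⟨
      (1# + M) + (- 1# - N)                         ≈⟨ +-congˡ (-‿+-comm 1# N) ⟩
      (1# + M) - (1# + N)                           ≈⟨ +-cong (×-homo-+ 1# 1 m) (-‿cong (×-homo-+ 1# 1 n)) ⟨
      (suc m ×′ 1#) - (suc n ×′ 1#)                 ∎
      where
      open SetoidReasoning setoid
      M = m ×′ 1#
      N = n ×′ 1#

    -‿homo : ∀ i → ⟦ ℤ.- i ⟧ ≈ - ⟦ i ⟧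
    -‿homo (+ zero)    = sym -0#≈0#
    -‿homo ℤ.+[1+ n ]  = refl
    -‿homo -[1+ n ]    = sym (-‿involutive _)

    +-homo : ∀ i j → ⟦ i ℤ.+ j ⟧ ≈ ⟦ i ⟧ + ⟦ j ⟧
    +-homo (+ m)    (+ n)    = ×-homo-+ 1# m n
    +-homo (+ m)    -[1+ n ] = ⊖-homo m (suc n)
    +-homo -[1+ m ] (+ n)    = trans (⊖-homo n (suc m)) (+-comm _ _)
    +-homo -[1+ m ] -[1+ n ] = trans (-‿cong (trans (reflexive (≡.cong (_×′ 1#) (≡.cong suc (≡.sym (ℕₚ.+-suc m n)))))
                                                    (×-homo-+ 1# (suc m) (suc n))))
                                     (sym (-‿+-comm _ _))

    *-homo⁺ : ∀ m n → ⟦ (+ m) ℤ.* (+ n) ⟧ ≈ ⟦ + m ⟧ * ⟦ + n ⟧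
    *-homo⁺ m n = trans (reflexive (≡.cong ⟦_⟧ (≡.sym (ℤₚ.pos-* m n)))) (×1-homo-* m n)

    *-homo : ∀ i j → ⟦ i ℤ.* j ⟧ ≈ ⟦ i ⟧ * ⟦ j ⟧
    *-homo (+ m)    (+ n)    = *-homo⁺ m n
    *-homo (+ m)    -[1+ n ] =
      trans (reflexive (≡.cong ⟦_⟧ (≡.sym (ℤₚ.neg-distribʳ-* (+ m) (+ suc n)))))
      (trans (-‿homo ((+ m) ℤ.* (+ suc n)))
      (trans (-‿cong (*-homo⁺ m (suc n))) (-‿distribʳ-* _ _)))
    *-homo -[1+ m ] (+ n)    =
      trans (reflexive (≡.cong ⟦_⟧ (≡.sym (ℤₚ.neg-distribˡ-* (+ suc m) (+ n)))))
      (trans (-‿homo ((+ suc m) ℤ.* (+ n)))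
      (trans (-‿cong (*-homo⁺ (suc m) n)) (-‿distribˡ-* _ _)))
    *-homo -[1+ m ] -[1+ n ] =
      trans (*-homo⁺ (suc m) (suc n))
      (trans (sym (-‿involutive _))
      (trans (-‿cong (-‿distribʳ-* _ _)) (-‿distribˡ-* _ _)))

    ℤ-rawRing : RawRing _ _
    ℤ-rawRing = record
      { Carrier = ℤ ; _≈_ = _≡_ ; _+_ = ℤ._+_ ; _*_ = ℤ._*_ ; -_ = ℤ.-_
      ; 0# = + 0 ; 1# = + 1 }

    homomorphism : ℤ-rawRing -Raw-AlmostCommutative⟶ fromCommutativeRing commutativeRing
    homomorphism = record
      { ⟦_⟧ = ⟦_⟧ ; +-homo = +-homo ; *-homo = *-homo ; -‿homo = -‿homo
      ; 0-homo = refl ; 1-homo = refl }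

    ≈-coeff? : ∀ i j → Maybe (⟦ i ⟧ ≈ ⟦ j ⟧)
    ≈-coeff? i j with i ℤₚ.≟ j
    ... | yes ≡.refl = just refl
    ... | no _       = nothing

  open RingSolver ℤ-rawRing (fromCommutativeRing commutativeRing) homomorphism ≈-coeff? public
    using (Polynomial; solve; _:=_; _:+_; _:*_; _:-_; :-_; con)

  :1 : ∀ {n} → Polynomial n
  :1 = con (+ 1)

  open IsTotalOrder isTotalOrder public using (total)
    renaming (refl to ≤-refl; reflexive to ≤-reflexive; trans to ≤-trans; antisym to ≤-antisym)

  private
    poset : Poset _ _ _
    poset = record { isPartialOrder = IsTotalOrder.isPartialOrder isTotalOrder }

  open Poset poset public using () renaming (≤-respˡ-≈ to ≤-respˡ; ≤-respʳ-≈ to ≤-respʳ)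
  module ≤-Reasoning = PartialOrderReasoning poset
  module ≈-Reasoning = SetoidReasoning setoid

  2# : ℝ
  2# = 1# + 1#

  fromℕ2≈2 : fromℕ 2 ≈ 2#
  fromℕ2≈2 = +-congˡ (+-identityʳ 1#)

  x^2≈x*x : ∀ x → x ^ 2 ≈ x * x
  x^2≈x*x x = *-congˡ (*-identityʳ x)

  <⇒≤ : ∀ {x y} → x < y → x ≤ y
  <⇒≤ = proj₁

  <⇒≱ : ∀ {x y} → x < y → ¬ (y ≤ x)
  <⇒≱ (x≤y , x≉y) y≤x = x≉y (≤-antisym x≤y y≤x)

  ≰⇒> : ∀ {x y} → ¬ (y ≤ x) → x < y
  ≰⇒> {x} {y} y≰x with total x y
  ... | inj₁ x≤y = x≤y , λ x≈y → y≰x (≤-reflexive (sym x≈y))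
  ... | inj₂ y≤x = contradiction y≤x y≰x

  ≤-<-trans : ∀ {x y z} → x ≤ y → y < z → x < z
  ≤-<-trans x≤y y<z = ≰⇒> λ z≤x → <⇒≱ y<z (≤-trans z≤x x≤y)

  <-≤-trans : ∀ {x y z} → x < y → y ≤ z → x < z
  <-≤-trans x<y y≤z = ≰⇒> λ z≤x → <⇒≱ x<y (≤-trans y≤z z≤x)

  +-monoʳ-≤ : ∀ z {x y} → x ≤ y → z + x ≤ z + y
  +-monoʳ-≤ z x≤y = ≤-respˡ (+-comm _ z) (≤-respʳ (+-comm _ z) (+-monoˡ-≤ z x≤y))

  +-mono-≤ : ∀ {x y u v} → x ≤ y → u ≤ v → x + u ≤ y + v
  +-mono-≤ x≤y u≤v = ≤-trans (+-monoˡ-≤ _ x≤y) (+-monoʳ-≤ _ u≤v)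

  x≤y⇒0≤y-x : ∀ {x y} → x ≤ y → 0# ≤ y - x
  x≤y⇒0≤y-x {x} x≤y = ≤-respˡ (-‿inverseʳ x) (+-monoˡ-≤ (- x) x≤y)

  -- Polynomial inequalities are proved by exhibiting y - x as a z of known
  -- sign, the equation being left to the ring solver.
  x+z≈y⇒x≤y : ∀ {x y z} → 0# ≤ z → x + z ≈ y → x ≤ y
  x+z≈y⇒x≤y {x} 0≤z eq = ≤-respˡ (+-identityʳ x) (≤-respʳ eq (+-monoʳ-≤ x 0≤z))

  0≤y-x⇒x≤y : ∀ {x y} → 0# ≤ y - x → x ≤ y
  0≤y-x⇒x≤y {x} {y} 0≤ = x+z≈y⇒x≤y 0≤ (solve 2 (λ x y → x :+ (y :- x) := y) refl x y)

  neg-mono-≤ : ∀ {x y} → x ≤ y → - y ≤ - x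
  neg-mono-≤ {x} {y} x≤y = x+z≈y⇒x≤y (x≤y⇒0≤y-x x≤y)
    (solve 2 (λ x y → :- y :+ (y :- x) := :- x) refl x y)

  +-cancelˡ-≤ : ∀ z {x y} → z + x ≤ z + y → x ≤ y
  +-cancelˡ-≤ z {x} {y} p = x+z≈y⇒x≤y (x≤y⇒0≤y-x p)
    (solve 3 (λ x y z → x :+ (z :+ y :- (z :+ x)) := y) refl x y z)

  +-mono-<-≤ : ∀ {x y u v} → x < y → u ≤ v → x + u < y + v
  +-mono-<-≤ {x} {y} {u} {v} x<y u≤v = ≰⇒> λ p → <⇒≱ x<y
    (+-cancelˡ-≤ v (≤-respˡ (+-comm y v) (≤-trans p
      (≤-respʳ (+-comm x v) (+-monoʳ-≤ x u≤v)))))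

  +-mono-≤-< : ∀ {x y u v} → x ≤ y → u < v → x + u < y + v
  +-mono-≤-< {x} {y} {u} {v} x≤y u<v = ≰⇒> λ p → <⇒≱ u<v
    (+-cancelˡ-≤ y (≤-trans p (+-monoˡ-≤ u x≤y)))

  +-nonneg : ∀ {x y} → 0# ≤ x → 0# ≤ y → 0# ≤ x + y
  +-nonneg 0≤x 0≤y = ≤-respˡ (+-identityʳ 0#) (+-mono-≤ 0≤x 0≤y)

  +-pos : ∀ {x y} → 0# < x → 0# ≤ y → 0# < x + y
  +-pos 0<x 0≤y = <-≤-trans 0<x (≤-respˡ (+-identityʳ _) (+-monoʳ-≤ _ 0≤y))

  x≤x+y : ∀ {x y} → 0# ≤ y → x ≤ x + y
  x≤x+y 0≤y = x+z≈y⇒x≤y 0≤y refl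

  x≤y+x : ∀ {x y} → 0# ≤ y → x ≤ y + x
  x≤y+x 0≤y = x+z≈y⇒x≤y 0≤y (+-comm _ _)

  *-monoˡ-≤ : ∀ {x y z} → 0# ≤ z → x ≤ y → z * x ≤ z * y
  *-monoˡ-≤ {x} {y} {z} 0≤z x≤y = x+z≈y⇒x≤y (*-nonneg 0≤z (x≤y⇒0≤y-x x≤y))
    (solve 3 (λ x y z → z :* x :+ z :* (y :- x) := z :* y) refl x y z)

  *-monoʳ-≤ : ∀ {x y z} → 0# ≤ z → x ≤ y → x * z ≤ y * z
  *-monoʳ-≤ 0≤z x≤y = ≤-respˡ (*-comm _ _) (≤-respʳ (*-comm _ _) (*-monoˡ-≤ 0≤z x≤y))

  *-mono-≤ : ∀ {x y u v} → 0# ≤ y → 0# ≤ u → x ≤ y → u ≤ v → x * u ≤ y * v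
  *-mono-≤ 0≤y 0≤u x≤y u≤v = ≤-trans (*-monoʳ-≤ 0≤u x≤y) (*-monoˡ-≤ 0≤y u≤v)

  square-nonneg : ∀ x → 0# ≤ x * x
  square-nonneg x with total 0# x
  ... | inj₁ 0≤x = *-nonneg 0≤x 0≤x
  ... | inj₂ x≤0 = ≤-respʳ (solve 1 (λ x → (:- x) :* (:- x) := x :* x) refl x)
    (*-nonneg 0≤-x 0≤-x)
    where
    0≤-x : 0# ≤ - x
    0≤-x = ≤-respˡ -0#≈0# (neg-mono-≤ x≤0)

  0≤1 : 0# ≤ 1#
  0≤1 = ≤-respʳ (*-identityʳ 1#) (square-nonneg 1#)

  0<1 : 0# < 1#
  0<1 = 0≤1 , 0≉1

  0<2 : 0# < 2#
  0<2 = +-pos 0<1 0≤1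

  pos⇒≉0 : ∀ {x} → 0# < x → ¬ (x ≈ 0#)
  pos⇒≉0 (_ , 0≉x) x≈0 = 0≉x (sym x≈0)

  *-inverse-pos : ∀ {x} → 0# < x → x * x ⁻¹ ≈ 1#
  *-inverse-pos 0<x = *-inverseʳ (pos⇒≉0 0<x)

  ⁻¹-pos : ∀ {x} → 0# < x → 0# < x ⁻¹
  ⁻¹-pos {x} 0<x = ≰⇒> λ p → <⇒≱ 0<1
    (≤-respˡ (*-inverse-pos 0<x) (≤-respʳ (zeroʳ x) (*-monoˡ-≤ (<⇒≤ 0<x) p)))

  *-cancelˡ-≤ : ∀ {z x y} → 0# < z → z * x ≤ z * y → x ≤ y
  *-cancelˡ-≤ {z} {x} {y} 0<z p = ≤-respˡ (lem x) (≤-respʳ (lem y) (*-monoˡ-≤ (<⇒≤ (⁻¹-pos 0<z)) p))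
    where
    lem : ∀ x → z ⁻¹ * (z * x) ≈ x
    lem x = trans (sym (*-assoc _ _ _)) (trans (*-congʳ (trans (*-comm _ _) (*-inverse-pos 0<z))) (*-identityˡ x))

  *-cancelˡ-< : ∀ {z x y} → 0# ≤ z → z * x < z * y → x < y
  *-cancelˡ-< 0≤z p = ≰⇒> λ y≤x → <⇒≱ p (*-monoˡ-≤ 0≤z y≤x)

  *-monoˡ-< : ∀ {z x y} → 0# < z → x < y → z * x < z * y
  *-monoˡ-< 0<z x<y = ≰⇒> λ p → <⇒≱ x<y (*-cancelˡ-≤ 0<z p)

  1≤a∧a*b≤c⇒b≤c : ∀ {a b c} → 1# ≤ a → 0# ≤ c → a * b ≤ c → b ≤ c
  1≤a∧a*b≤c⇒b≤c {b = b} 1≤a 0≤c ab≤c with total 0# b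
  ... | inj₁ 0≤b = ≤-trans (≤-respˡ (*-identityˡ b) (*-monoʳ-≤ 0≤b 1≤a)) ab≤c
  ... | inj₂ b≤0 = ≤-trans b≤0 0≤c

  *-pos : ∀ {x y} → 0# < x → 0# < y → 0# < x * y
  *-pos {x} 0<x 0<y = ≤-<-trans (≤-reflexive (sym (zeroʳ x))) (*-monoˡ-< 0<x 0<y)

  *-cancel-/ : ∀ {x y} → 0# < y → y * (x / y) ≈ x
  *-cancel-/ {x} {y} 0<y = trans (solve 3 (λ x y i → y :* (x :* i) := x :* (y :* i)) refl x y (y ⁻¹))
    (trans (*-congˡ (*-inverse-pos 0<y)) (*-identityʳ x))

  /-pos : ∀ {x y} → 0# < x → 0# < y → 0# < x / y
  /-pos 0<x 0<y = *-pos 0<x (⁻¹-pos 0<y)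

  fromℕ-* : ∀ m n → fromℕ (m ℕ.* n) ≈ fromℕ m * fromℕ n
  fromℕ-* = Mult.×1-homo-* semiring

  fromℕ-nonneg : ∀ n → 0# ≤ fromℕ n
  fromℕ-nonneg zero    = ≤-refl
  fromℕ-nonneg (suc n) = +-nonneg 0≤1 (fromℕ-nonneg n)

  1≤fromℕ : ∀ {n} → 0 ℕ.< n → 1# ≤ fromℕ n
  1≤fromℕ {suc n} _ = x≤x+y (fromℕ-nonneg n)

  fromℕ-pos : ∀ {n} → 0 ℕ.< n → 0# < fromℕ n
  fromℕ-pos 0<n = <-≤-trans 0<1 (1≤fromℕ 0<n)

  fromℕ-mono-≤ : ∀ {m n} → m ℕ.≤ n → fromℕ m ≤ fromℕ n
  fromℕ-mono-≤ {n = n} ℕ.z≤n = fromℕ-nonneg n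
  fromℕ-mono-≤ (ℕ.s≤s m≤n)   = +-monoʳ-≤ 1# (fromℕ-mono-≤ m≤n)

-- Finite sums and products.

module FiniteSums (ℛ : Reals) where

  open Reals ℛ hiding (zero)
  open RealArithmetic ℛ
  open SemiringSum semiring public using (sum-cong-≋; ∑-distrib-+; *-distribˡ-sum)

  sum-mono-≤ : ∀ {n} {f g : Fin n → ℝ} → (∀ i → f i ≤ g i) → sum f ≤ sum g
  sum-mono-≤ {zero}  f≤g = ≤-refl
  sum-mono-≤ {suc n} f≤g = +-mono-≤ (f≤g Fin.zero) (sum-mono-≤ (f≤g ∘ Fin.suc))

  sum-nonneg : ∀ {n} {f : Fin n → ℝ} → (∀ i → 0# ≤ f i) → 0# ≤ sum f
  sum-nonneg {zero}  0≤f = ≤-refl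
  sum-nonneg {suc n} 0≤f = +-nonneg (0≤f Fin.zero) (sum-nonneg (0≤f ∘ Fin.suc))

  product-cong : ∀ {n} {f g : Fin n → ℝ} → (∀ i → f i ≈ g i) → product f ≈ product g
  product-cong {zero}  f≈g = refl
  product-cong {suc n} f≈g = *-cong (f≈g Fin.zero) (product-cong (f≈g ∘ Fin.suc))

  product-nonneg : ∀ {n} {f : Fin n → ℝ} → (∀ i → 0# ≤ f i) → 0# ≤ product f
  product-nonneg {zero}  0≤f = 0≤1
  product-nonneg {suc n} 0≤f = *-nonneg (0≤f Fin.zero) (product-nonneg (0≤f ∘ Fin.suc))

  product-≈1 : ∀ {n} {f : Fin n → ℝ} → (∀ i → f i ≈ 1#) → product f ≈ 1#
  product-≈1 {zero}  f≈1 = refl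
  product-≈1 {suc n} f≈1 = trans (*-cong (f≈1 Fin.zero) (product-≈1 (f≈1 ∘ Fin.suc))) (*-identityʳ 1#)

  product-*-distrib : ∀ {n} (f g : Fin n → ℝ) → product f * product g ≈ product (λ i → f i * g i)
  product-*-distrib {zero}  f g = *-identityʳ 1#
  product-*-distrib {suc n} f g =
    trans (solve 4 (λ a b c d → (a :* b) :* (c :* d) := (a :* c) :* (b :* d)) refl _ _ _ _)
          (*-congˡ (product-*-distrib (f ∘ Fin.suc) (g ∘ Fin.suc)))

  product-≈0 : ∀ {n} {f : Fin n → ℝ} i → f i ≈ 0# → product f ≈ 0#
  product-≈0 Fin.zero    fi≈0 = trans (*-congʳ fi≈0) (zeroˡ _)
  product-≈0 (Fin.suc i) fi≈0 = trans (*-congˡ (product-≈0 i fi≈0)) (zeroʳ _)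

  -- With `y` the least of the first `k` values, this is the averaging argument that turns a bound
  -- on the total cost into one for the cheapest core node.
  many-small-sum : ∀ {n k y} (f : Fin n → ℝ) → (∀ i → 0# ≤ f i) → k ℕ.≤ n →
                   (∀ i → toℕ i ℕ.< k → y ≤ f i) → fromℕ k * y ≤ sum f
  many-small-sum {k = zero} f 0≤f _ _ = ≤-respˡ (sym (zeroˡ _)) (sum-nonneg 0≤f)
  many-small-sum {suc n} {suc k} {y} f 0≤f (ℕ.s≤s k≤n) y≤f =
    ≤-respˡ (solve 2 (λ k y → y :+ k :* y := (:1 :+ k) :* y) refl (fromℕ k) y)
      (+-mono-≤ (y≤f Fin.zero (ℕ.s≤s ℕ.z≤n))
                (many-small-sum (f ∘ Fin.suc) (0≤f ∘ Fin.suc) k≤n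
                  (λ i i<k → y≤f (Fin.suc i) (ℕ.s≤s i<k))))

  minimum-below : ∀ {n k} (f : Fin n → ℝ) → 0 ℕ.< k → k ℕ.≤ n →
                  ∃ λ u → (toℕ u ℕ.< k) × (∀ i → toℕ i ℕ.< k → f u ≤ f i)
  minimum-below {suc n} {suc zero} f _ _ =
    Fin.zero , ℕ.s≤s ℕ.z≤n , λ { Fin.zero _ → ≤-refl ; (Fin.suc i) (ℕ.s≤s ()) }
  minimum-below {suc n} {suc (suc k)} f _ (ℕ.s≤s k<n) =
    compare (minimum-below (f ∘ Fin.suc) (ℕ.s≤s ℕ.z≤n) k<n)
    where
    compare : (∃ λ u → (toℕ u ℕ.< suc k) × (∀ i → toℕ i ℕ.< suc k → f (Fin.suc u) ≤ f (Fin.suc i))) →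
              ∃ λ u → (toℕ u ℕ.< suc (suc k)) × (∀ i → toℕ i ℕ.< suc (suc k) → f u ≤ f i)
    compare (u , u<k , min) with total (f Fin.zero) (f (Fin.suc u))
    ... | inj₁ f₀≤ = Fin.zero , ℕ.s≤s ℕ.z≤n ,
      λ { Fin.zero _ → ≤-refl ; (Fin.suc i) (ℕ.s≤s i<k) → ≤-trans f₀≤ (min i i<k) }
    ... | inj₂ ≤f₀ = Fin.suc u , ℕ.s≤s u<k ,
      λ { Fin.zero _ → ≤f₀ ; (Fin.suc i) (ℕ.s≤s i<k) → min i i<k }

-- Partial sums of the exponential series.

module Exponential (ℛ : Reals) where

  open Reals ℛ hiding (zero)
  open RealArithmetic ℛ
  open FiniteSums ℛ

  S : (ℕ → ℝ) → ℕ → ℝ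
  S a M = sum {M} λ j → a (toℕ j)

  S-snoc : ∀ a M → S a (suc M) ≈ S a M + a M
  S-snoc a zero    = +-comm _ _
  S-snoc a (suc M) = trans (+-congˡ (S-snoc (a ∘ suc) M)) (sym (+-assoc _ _ _))

  S-nonneg : ∀ {a} → (∀ i → 0# ≤ a i) → ∀ M → 0# ≤ S a M
  S-nonneg 0≤a M = sum-nonneg {M} (0≤a ∘ toℕ)

  S-mono : ∀ {a} → (∀ i → 0# ≤ a i) → ∀ {M N} → M ℕ.≤ N → S a M ≤ S a N
  S-mono 0≤a {N = N} ℕ.z≤n  = S-nonneg 0≤a N
  S-mono 0≤a (ℕ.s≤s M≤N) = +-monoʳ-≤ _ (S-mono (0≤a ∘ suc) M≤N)

  term : ℝ → ℕ → ℝ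
  term x j = x ^ j / fromℕ (j ℕ.!)

  fact-pos : ∀ j → 0# < fromℕ (j ℕ.!)
  fact-pos j = fromℕ-pos (ℕₚ.1≤n! j)

  term-zero : ∀ x → term x 0 ≈ 1#
  term-zero x = trans (*-congʳ (sym (+-identityʳ 1#))) (*-inverse-pos (fact-pos 0))

  -- This recurrence carries the inductions below: inequalities between terms are proved after
  -- multiplication by `fromℕ (suc j)`, which keeps factorials out of them.
  term-suc : ∀ x j → fromℕ (suc j) * term x (suc j) ≈ x * term x j
  term-suc x j = begin
    s * t                              ≈⟨ *-identityʳ _ ⟨
    s * t * 1#                         ≈⟨ *-congˡ (*-inverse-pos (fact-pos j)) ⟨
    s * t * (f * f ⁻¹)                 ≈⟨ solve 4 (λ s t f i → s :* t :* (f :* i) := (s :* f) :* t :* i) refl s t f (f ⁻¹) ⟩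
    (s * f) * t * f ⁻¹                 ≈⟨ *-congʳ (*-congʳ (fromℕ-* (suc j) (j ℕ.!))) ⟨
    fromℕ (suc j ℕ.!) * t * f ⁻¹       ≈⟨ *-congʳ (*-cancel-/ (fact-pos (suc j))) ⟩
    x ^ suc j * f ⁻¹                   ≈⟨ *-assoc _ _ _ ⟩
    x * term x j                       ∎
    where
    open ≈-Reasoning
    s = fromℕ (suc j)
    t = term x (suc j)
    f = fromℕ (j ℕ.!)

  fromℕ-suc-pos : ∀ j → 0# < fromℕ (suc j)
  fromℕ-suc-pos j = fromℕ-pos {suc j} (ℕ.s≤s ℕ.z≤n)

  term-nonneg : ∀ {x} → 0# ≤ x → ∀ j → 0# ≤ term x j
  term-nonneg {x} 0≤x zero    = ≤-respʳ (sym (term-zero x)) 0≤1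
  term-nonneg {x} 0≤x (suc j) = *-cancelˡ-≤ (fromℕ-suc-pos j)
    (≤-respˡ (sym (zeroʳ _)) (≤-respʳ (sym (term-suc x j)) (*-nonneg 0≤x (term-nonneg 0≤x j))))

  term-mono : ∀ {x y} → 0# ≤ x → x ≤ y → ∀ j → term x j ≤ term y j
  term-mono {x} {y} 0≤x x≤y zero = ≤-reflexive (trans (term-zero x) (sym (term-zero y)))
  term-mono {x} {y} 0≤x x≤y (suc j) = *-cancelˡ-≤ (fromℕ-suc-pos j)
    (≤-respˡ (sym (term-suc x j)) (≤-respʳ (sym (term-suc y j))
      (*-mono-≤ (≤-trans 0≤x x≤y) (term-nonneg 0≤x j) x≤y (term-mono 0≤x x≤y j))))

  term-cong : ∀ {x y} → x ≈ y → ∀ j → term x j ≈ term y j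
  term-cong x≈y zero = refl
  term-cong {x} {y} x≈y (suc j) = *-congʳ (^-congˡ (suc j))
    where
    ^-congˡ : ∀ j → x ^ j ≈ y ^ j
    ^-congˡ zero    = refl
    ^-congˡ (suc j) = *-cong x≈y (^-congˡ j)

  module _ {x p : ℝ} (0≤x : 0# ≤ x) (0≤p : 0# ≤ p) where

    private
      0≤x+p : 0# ≤ x + p
      0≤x+p = +-nonneg 0≤x 0≤p

    -- (x + p)^m ≤ x^m + m p (x + p)^(m-1), divided by m!.
    term-+-≤ : ∀ j → term (x + p) (suc j) ≤ term x (suc j) + p * term (x + p) j
    term-+-≤ zero = ≤-reflexive (begin
      t₁                     ≈⟨ *-identityˡ _ ⟨
      1# * t₁                ≈⟨ *-congʳ (+-identityʳ _) ⟨
      fromℕ 1 * t₁           ≈⟨ term-suc (x + p) 0 ⟩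
      (x + p) * t₀           ≈⟨ distribʳ _ _ _ ⟩
      x * t₀ + p * t₀        ≈⟨ +-congʳ (*-congˡ (trans (term-zero (x + p)) (sym (term-zero x)))) ⟩
      x * term x 0 + p * t₀  ≈⟨ +-congʳ (term-suc x 0) ⟨
      fromℕ 1 * term x 1 + p * t₀ ≈⟨ +-congʳ (*-congʳ (+-identityʳ _)) ⟩
      1# * term x 1 + p * t₀ ≈⟨ +-congʳ (*-identityˡ _) ⟩
      term x 1 + p * t₀      ∎)
      where
      open ≈-Reasoning
      t₁ = term (x + p) 1
      t₀ = term (x + p) 0
    term-+-≤ (suc j) = *-cancelˡ-≤ (fromℕ-suc-pos (suc j)) (begin
      fromℕ (2 ℕ.+ j) * term (x + p) (2 ℕ.+ j)   ≈⟨ term-suc (x + p) (suc j) ⟩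
      (x + p) * t₁                               ≈⟨ distribʳ _ _ _ ⟩
      x * t₁ + p * t₁                            ≤⟨ +-monoˡ-≤ _ (*-monoˡ-≤ 0≤x (term-+-≤ j)) ⟩
      -- The slack `p * p * t₀` completes `p * (x * t₀)` to `p * ((x + p) * t₀)`, to which the
      -- recurrence applies again.
      x * (s₁ + p * t₀) + p * t₁                 ≤⟨ +-monoˡ-≤ _ (x≤x+y (*-nonneg (*-nonneg 0≤p 0≤p) (term-nonneg 0≤x+p j))) ⟩
      x * (s₁ + p * t₀) + p * p * t₀ + p * t₁    ≈⟨ solve 5 (λ x p s₁ t₀ t₁ → x :* (s₁ :+ p :* t₀) :+ p :* p :* t₀ :+ p :* t₁
                                                       := x :* s₁ :+ p :* ((x :+ p) :* t₀) :+ p :* t₁) refl x p s₁ t₀ t₁ ⟩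
      x * s₁ + p * ((x + p) * t₀) + p * t₁       ≈⟨ +-congʳ (+-cong (term-suc x (suc j)) (*-congˡ (term-suc (x + p) j))) ⟨
      (1# + n) * s₂ + p * (n * t₁) + p * t₁      ≈⟨ solve 4 (λ p n s₂ t₁ → (:1 :+ n) :* s₂ :+ p :* (n :* t₁) :+ p :* t₁
                                                       := (:1 :+ n) :* (s₂ :+ p :* t₁)) refl p n s₂ t₁ ⟩
      (1# + n) * (s₂ + p * t₁)                   ∎)
      where
      open ≤-Reasoning
      n = fromℕ (suc j)
      s₁ = term x (suc j)
      s₂ = term x (suc (suc j))
      t₀ = term (x + p) j
      t₁ = term (x + p) (suc j)

    private
      S-shift-≤ : ∀ M → S (term (x + p) ∘ suc) M ≤ S (term x ∘ suc) M + p * S (term (x + p)) M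
      S-shift-≤ zero    = ≤-reflexive (sym (trans (+-identityˡ _) (zeroʳ p)))
      S-shift-≤ (suc M) = begin
        S (term (x + p) ∘ suc) (suc M)                                        ≈⟨ S-snoc (term (x + p) ∘ suc) M ⟩
        S (term (x + p) ∘ suc) M + term (x + p) (suc M)                       ≤⟨ +-mono-≤ (S-shift-≤ M) (term-+-≤ M) ⟩
        (S (term x ∘ suc) M + p * S (term (x + p)) M) + (term x (suc M) + p * term (x + p) M)
          ≈⟨ solve 5 (λ p a b c d → (a :+ p :* b) :+ (c :+ p :* d) := (a :+ c) :+ p :* (b :+ d)) refl p _ _ _ _ ⟩
        (S (term x ∘ suc) M + term x (suc M)) + p * (S (term (x + p)) M + term (x + p) M)
          ≈⟨ +-cong (S-snoc (term x ∘ suc) M) (*-congˡ (S-snoc (term (x + p)) M)) ⟨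
        S (term x ∘ suc) (suc M) + p * S (term (x + p)) (suc M)               ∎
        where open ≤-Reasoning

    -- The finite form of 1 - p ≤ e^(-p). Summing `term-+-≤` bounds the longer sum at `x + p` by the
    -- one at `x` plus `p` times a sum at `x + p` that is one term shorter; lengthening the latter
    -- only weakens the bound.
    expSeries-+-≤ : ∀ M → (1# - p) * expSeries (x + p) M ≤ expSeries x M
    expSeries-+-≤ zero = ≤-reflexive (zeroʳ _)
    expSeries-+-≤ (suc M) = begin
      (1# - p) * E                              ≈⟨ solve 2 (λ p E → (:1 :- p) :* E := E :- p :* E) refl p E ⟩
      E - p * E                                 ≤⟨ +-monoˡ-≤ _ (+-mono-≤ (≤-reflexive (trans (term-zero (x + p)) (sym (term-zero x)))) (S-shift-≤ M)) ⟩
      (term x 0 + (S (term x ∘ suc) M + p * E₋)) - p * E ≤⟨ +-monoˡ-≤ _ (+-monoʳ-≤ _ (+-monoʳ-≤ _ (*-monoˡ-≤ 0≤p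
                                                             (S-mono (term-nonneg 0≤x+p) (ℕₚ.n≤1+n M))))) ⟩
      (term x 0 + (S (term x ∘ suc) M + p * E)) - p * E ≈⟨ solve 4 (λ p E a b → (a :+ (b :+ p :* E)) :- p :* E := a :+ b) refl p E _ _ ⟩
      expSeries x (suc M)                       ∎
      where
      open ≤-Reasoning
      E = expSeries (x + p) (suc M)
      E₋ = expSeries (x + p) M

  expSeries-0-≤1 : ∀ {x} → x ≈ 0# → ∀ M → expSeries x M ≤ 1#
  expSeries-0-≤1 x≈0 zero    = 0≤1
  expSeries-0-≤1 {x} x≈0 (suc M) = ≤-reflexive (trans (+-cong (term-zero x) (vanish M (term x ∘ suc) term≈0)) (+-identityʳ 1#))
    where
    term≈0 : ∀ j → term x (suc j) ≈ 0#
    term≈0 j = trans (*-congʳ (trans (*-congʳ x≈0) (zeroˡ _))) (zeroˡ _)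
    vanish : ∀ M a → (∀ j → a j ≈ 0#) → S a M ≈ 0#
    vanish zero    a a≈0 = refl
    vanish (suc M) a a≈0 = trans (+-cong (a≈0 0) (vanish M (a ∘ suc) (a≈0 ∘ suc))) (+-identityʳ 0#)

  -- Each factor `1# - f i` pays for removing `f i` from the argument of the series. Working with
  -- partial sums leaves a single passage to the limit for the end.
  product-*-expSeries-≤1 : ∀ {n} (f : Fin n → ℝ) → (∀ i → 0# ≤ f i) → (∀ i → f i ≤ 1#) → ∀ M →
                           product (λ i → 1# - f i) * expSeries (sum f) M ≤ 1#
  product-*-expSeries-≤1 {zero} f _ _ M = ≤-respˡ (sym (*-identityˡ _)) (expSeries-0-≤1 refl M)
  product-*-expSeries-≤1 {suc n} f 0≤f f≤1 M = begin
    (1# - f₀) * Π * expSeries (f₀ + σ) M     ≈⟨ *-congˡ (sum-cong-≋ {n = M} (λ j → term-cong (+-comm f₀ σ) (toℕ j))) ⟩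
    (1# - f₀) * Π * expSeries (σ + f₀) M     ≈⟨ solve 3 (λ a b c → a :* b :* c := b :* (a :* c)) refl _ _ _ ⟩
    Π * ((1# - f₀) * expSeries (σ + f₀) M)   ≤⟨ *-monoˡ-≤ (product-nonneg λ i → x≤y⇒0≤y-x (f≤1 (Fin.suc i)))
                                                  (expSeries-+-≤ (sum-nonneg (0≤f ∘ Fin.suc)) (0≤f Fin.zero) M) ⟩
    Π * expSeries σ M                        ≤⟨ product-*-expSeries-≤1 (f ∘ Fin.suc) (0≤f ∘ Fin.suc) (f≤1 ∘ Fin.suc) M ⟩
    1#                                       ∎
    where
    open ≤-Reasoning
    f₀ = f Fin.zero
    σ = sum (f ∘ Fin.suc)
    Π = product (λ i → 1# - f (Fin.suc i))

-- Cauchy products, applied to the series of exp t and exp (- t).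

module CauchyProduct (ℛ : Reals) where

  open Reals ℛ hiding (zero)
  open RealArithmetic ℛ
  open FiniteSums ℛ
  open Exponential ℛ

  -- The coefficient of index `m` of the Cauchy product. Recursion on the shift of `a` avoids
  -- subtraction of indices.
  conv : (ℕ → ℝ) → (ℕ → ℝ) → ℕ → ℝ
  conv a b zero    = a 0 * b 0
  conv a b (suc m) = a 0 * b (suc m) + conv (a ∘ suc) b m

  -- The sum of a i * b j over i + j < M.
  triangle : (ℕ → ℝ) → (ℕ → ℝ) → ℕ → ℝ
  triangle a b zero    = 0#
  triangle a b (suc M) = a 0 * S b (suc M) + triangle (a ∘ suc) b M

  triangle-snoc : ∀ a b M → triangle a b (suc M) ≈ triangle a b M + conv a b M
  triangle-snoc a b zero = trans (+-identityʳ _) (trans (*-congˡ (+-identityʳ _)) (sym (+-identityˡ _)))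
  triangle-snoc a b (suc M) = begin
    a 0 * S b (2 ℕ.+ M) + triangle (a ∘ suc) b (suc M)
      ≈⟨ +-cong (*-congˡ (S-snoc b (suc M))) (triangle-snoc (a ∘ suc) b M) ⟩
    a 0 * (S b (suc M) + b (suc M)) + (triangle (a ∘ suc) b M + conv (a ∘ suc) b M)
      ≈⟨ solve 5 (λ a s b t c → a :* (s :+ b) :+ (t :+ c) := (a :* s :+ t) :+ (a :* b :+ c)) refl _ _ _ _ _ ⟩
    triangle a b (suc M) + conv a b (suc M) ∎
    where open ≈-Reasoning

  -- The shift s makes the recurrence stable under passing to the tail of a.
  conv-suc : ∀ {a b x y} s → (∀ i → (s + fromℕ (suc i)) * a (suc i) ≈ x * a i) →
             (∀ j → fromℕ (suc j) * b (suc j) ≈ y * b j) → ∀ m →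
             (s + fromℕ (suc m)) * conv a b (suc m) ≈ s * a 0 * b (suc m) + (x + y) * conv a b m
  conv-suc {a} {b} {x} {y} s a-suc b-suc zero = begin
    (s + f) * (a 0 * b 1 + a 1 * b 0)
      ≈⟨ solve 6 (λ s f a₀ a₁ b₀ b₁ → (s :+ f) :* (a₀ :* b₁ :+ a₁ :* b₀)
           := s :* a₀ :* b₁ :+ a₀ :* (f :* b₁) :+ ((s :+ f) :* a₁) :* b₀) refl s f _ _ _ _ ⟩
    s * a 0 * b 1 + a 0 * (f * b 1) + ((s + f) * a 1) * b 0
      ≈⟨ +-cong (+-congˡ (*-congˡ (b-suc 0))) (*-congʳ (a-suc 0)) ⟩
    s * a 0 * b 1 + a 0 * (y * b 0) + (x * a 0) * b 0
      ≈⟨ solve 6 (λ s x y a₀ b₀ b₁ → s :* a₀ :* b₁ :+ a₀ :* (y :* b₀) :+ (x :* a₀) :* b₀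
           := s :* a₀ :* b₁ :+ (x :+ y) :* (a₀ :* b₀)) refl s x y _ _ _ ⟩
    s * a 0 * b 1 + (x + y) * (a 0 * b 0) ∎
    where
    open ≈-Reasoning
    f = fromℕ 1
  conv-suc {a} {b} {x} {y} s a-suc b-suc (suc m) = begin
    (s + (1# + n)) * (a 0 * b (2 ℕ.+ m) + C)
      ≈⟨ solve 5 (λ s n a₀ b₂ C → (s :+ (:1 :+ n)) :* (a₀ :* b₂ :+ C)
           := s :* a₀ :* b₂ :+ a₀ :* ((:1 :+ n) :* b₂) :+ ((s :+ :1) :+ n) :* C) refl s n _ _ C ⟩
    s * a 0 * b (2 ℕ.+ m) + a 0 * ((1# + n) * b (2 ℕ.+ m)) + ((s + 1#) + n) * C
      ≈⟨ +-cong (+-congˡ (*-congˡ (b-suc (suc m)))) (conv-suc (s + 1#) a′-suc b-suc m) ⟩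
    s * a 0 * b (2 ℕ.+ m) + a 0 * (y * b (suc m)) + ((s + 1#) * a 1 * b (suc m) + (x + y) * C₀)
      ≈⟨ +-congˡ (+-congʳ (*-congʳ (trans (*-congʳ (+-congˡ (sym (+-identityʳ 1#)))) (a-suc 0)))) ⟩
    s * a 0 * b (2 ℕ.+ m) + a 0 * (y * b (suc m)) + (x * a 0 * b (suc m) + (x + y) * C₀)
      ≈⟨ solve 7 (λ s x y a₀ b₁ b₂ C₀ → s :* a₀ :* b₂ :+ a₀ :* (y :* b₁) :+ (x :* a₀ :* b₁ :+ (x :+ y) :* C₀)
           := s :* a₀ :* b₂ :+ (x :+ y) :* (a₀ :* b₁ :+ C₀)) refl s x y _ _ _ C₀ ⟩
    s * a 0 * b (2 ℕ.+ m) + (x + y) * (a 0 * b (suc m) + C₀) ∎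
    where
    open ≈-Reasoning
    n = fromℕ (suc m)
    C = conv (a ∘ suc) b (suc m)
    C₀ = conv (a ∘ suc) b m
    a′-suc : ∀ i → ((s + 1#) + fromℕ (suc i)) * a (2 ℕ.+ i) ≈ x * a (suc i)
    a′-suc i = trans (*-congʳ (+-assoc _ _ _)) (a-suc (suc i))

  -- Compares the tails from `N` to `M`; the initial parts are moved across so that no differences
  -- occur.
  S-tail-≤ : ∀ {b b̄ : ℕ → ℝ} → (∀ j → b j ≤ b̄ j) → ∀ {N M} → N ℕ.≤ M →
             S b M + S b̄ N ≤ S b̄ M + S b N
  S-tail-≤ b≤b̄ {M = M} ℕ.z≤n = +-monoˡ-≤ _ (sum-mono-≤ {M} (b≤b̄ ∘ toℕ))
  S-tail-≤ {b} {b̄} b≤b̄ {suc N} {suc M} (ℕ.s≤s N≤M) =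
    ≤-respˡ (solve 4 (λ p q u v → (p :+ q) :+ (u :+ v) := (p :+ u) :+ (q :+ v)) refl _ _ _ _)
    (≤-respʳ (solve 4 (λ p q u v → (p :+ q) :+ (u :+ v) := (q :+ u) :+ (p :+ v)) refl _ _ _ _)
    (+-monoʳ-≤ (b 0 + b̄ 0) (S-tail-≤ (b≤b̄ ∘ suc) N≤M)))

  -- The rectangle minus the triangle consists of the products `a i * b j` with `i < N`, `j < M` and
  -- `i + j ≥ N`. This remainder is monotone in `b`, because `a` is nonnegative.
  square-minus-triangle-≤ : ∀ {a b b̄ : ℕ → ℝ} → (∀ i → 0# ≤ a i) → (∀ j → b j ≤ b̄ j) →
    ∀ {N M} → N ℕ.≤ M → S a N * S b M + triangle a b̄ N ≤ S a N * S b̄ M + triangle a b N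
  square-minus-triangle-≤ 0≤a b≤b̄ {zero} _ =
    ≤-reflexive (+-congʳ (trans (zeroˡ _) (sym (zeroˡ _))))
  square-minus-triangle-≤ {a} {b} {b̄} 0≤a b≤b̄ {suc N} {M} N<M =
    ≤-respˡ (solve 6 (λ a₀ s u v w t → a₀ :* (u :+ w) :+ (s :* u :+ t) := (a₀ :+ s) :* u :+ (a₀ :* w :+ t)) refl
               (a 0) (S (a ∘ suc) N) (S b M) 0# (S b̄ (suc N)) (triangle (a ∘ suc) b̄ N))
    (≤-respʳ (solve 6 (λ a₀ s u v w t → a₀ :* (u :+ w) :+ (s :* u :+ t) := (a₀ :+ s) :* u :+ (a₀ :* w :+ t)) refl
               (a 0) (S (a ∘ suc) N) (S b̄ M) 0# (S b (suc N)) (triangle (a ∘ suc) b N))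
    (+-mono-≤ (*-monoˡ-≤ (0≤a 0) (S-tail-≤ b≤b̄ N<M))
              (square-minus-triangle-≤ (0≤a ∘ suc) b≤b̄ (ℕₚ.≤-trans (ℕₚ.n≤1+n N) N<M))))

  -- The rectangle `i < N`, `j < M` lies inside the triangle `i + j < N + M`.
  square-≤-triangle : ∀ {a b : ℕ → ℝ} → (∀ i → 0# ≤ a i) → (∀ j → 0# ≤ b j) →
    ∀ N M → S a N * S b M ≤ triangle a b (N ℕ.+ M)
  square-≤-triangle {a} {b} 0≤a 0≤b zero M = ≤-respˡ (sym (zeroˡ _)) (triangle-nonneg M 0≤a)
    where
    triangle-nonneg : ∀ M {a} → (∀ i → 0# ≤ a i) → 0# ≤ triangle a b M
    triangle-nonneg zero    _   = ≤-refl
    triangle-nonneg (suc M) 0≤a = +-nonneg (*-nonneg (0≤a 0) (S-nonneg 0≤b (suc M))) (triangle-nonneg M (0≤a ∘ suc))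
  square-≤-triangle 0≤a 0≤b (suc N) M = ≤-respˡ (sym (distribʳ _ _ _))
    (+-mono-≤ (*-monoˡ-≤ (0≤a 0) (S-mono 0≤b (ℕₚ.m≤n⇒m≤1+n (ℕₚ.m≤n+m M N))))
              (square-≤-triangle (0≤a ∘ suc) 0≤b N M))

  -- The two bounds need a joint induction: multiplying by `- t` turns each into the other.
  term-neg-bounds : ∀ {t} → 0# ≤ t → ∀ j → (- term t j ≤ term (- t) j) × (term (- t) j ≤ term t j)
  term-neg-bounds {t} 0≤t zero =
    ≤-trans (≤-trans (neg-mono-≤ (term-nonneg 0≤t 0)) (≤-reflexive -0#≈0#))
            (≤-respʳ (sym (term-zero (- t))) 0≤1) ,
    ≤-reflexive (trans (term-zero (- t)) (sym (term-zero t)))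
    where open RingProperties ring using (-0#≈0#)
  term-neg-bounds {t} 0≤t (suc j) with term-neg-bounds 0≤t j
  ... | lower , upper =
    *-cancelˡ-≤ (fromℕ-suc-pos j) (begin
      f * (- term t (suc j))     ≈⟨ solve 2 (λ f a → f :* (:- a) := :- (f :* a)) refl _ _ ⟩
      - (f * term t (suc j))     ≈⟨ -‿cong (term-suc t j) ⟩
      - (t * term t j)           ≤⟨ neg-mono-≤ (*-monoˡ-≤ 0≤t upper) ⟩
      - (t * term (- t) j)       ≈⟨ solve 2 (λ t a → :- (t :* a) := (:- t) :* a) refl _ _ ⟩
      - t * term (- t) j         ≈⟨ term-suc (- t) j ⟨
      f * term (- t) (suc j)     ∎) ,
    *-cancelˡ-≤ (fromℕ-suc-pos j) (begin
      f * term (- t) (suc j)     ≈⟨ term-suc (- t) j ⟩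
      - t * term (- t) j         ≈⟨ solve 2 (λ t a → (:- t) :* a := :- (t :* a)) refl _ _ ⟩
      - (t * term (- t) j)       ≤⟨ neg-mono-≤ (*-monoˡ-≤ 0≤t lower) ⟩
      - (t * (- term t j))       ≈⟨ solve 2 (λ t a → :- (t :* (:- a)) := t :* a) refl _ _ ⟩
      t * term t j               ≈⟨ term-suc t j ⟨
      f * term t (suc j)         ∎)
    where
    open ≤-Reasoning
    f = fromℕ (suc j)

  -- By `conv-suc` with shift 0, each coefficient after the first is a multiple of `t - t`, so only
  -- the constant term 1 survives.
  triangle-≈1 : ∀ t M → triangle (term t) (term (- t)) (suc M) ≈ 1#
  triangle-≈1 t zero = trans (triangle-snoc (term t) (term (- t)) 0) (trans (+-identityˡ _)
    (trans (*-cong (term-zero t) (term-zero (- t))) (*-identityʳ 1#)))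
  triangle-≈1 t (suc M) = trans (triangle-snoc (term t) (term (- t)) (suc M))
    (trans (+-cong (triangle-≈1 t M) conv≈0) (+-identityʳ 1#))
    where
    open ≈-Reasoning
    f = fromℕ (suc M)
    c = conv (term t) (term (- t)) (suc M)
    conv≈0 : c ≈ 0#
    conv≈0 = begin
      c                  ≈⟨ *-identityʳ c ⟨
      c * 1#             ≈⟨ *-congˡ (*-inverse-pos (fromℕ-suc-pos M)) ⟨
      c * (f * f ⁻¹)     ≈⟨ solve 3 (λ c f i → c :* (f :* i) := ((con (+ 0) :+ f) :* c) :* i) refl c f (f ⁻¹) ⟩
      ((0# + f) * c) * f ⁻¹ ≈⟨ *-congʳ (conv-suc 0# (λ i → trans (*-congʳ (+-identityˡ _)) (term-suc t i)) (term-suc (- t)) M) ⟩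
      (0# * term t 0 * term (- t) (suc M) + (t - t) * conv (term t) (term (- t)) M) * f ⁻¹
        ≈⟨ solve 5 (λ t u v w i → (con (+ 0) :* u :* v :+ (t :- t) :* w) :* i := con (+ 0)) refl t _ _ _ _ ⟩
      0#                 ∎

  -- The Cauchy product of the series of exp t and exp (- t) is 1, and the
  -- error of its partial products is dominated by that for exp t * exp t.
  expSeries-neg-≤ : ∀ {t} → 0# ≤ t → ∀ N → let n = suc N ; n₂ = n ℕ.+ n in
    expSeries t n₂ * expSeries (- t) n₂ + expSeries t n * expSeries t n ≤ expSeries t n₂ * expSeries t n₂ + 1#
  expSeries-neg-≤ {t} 0≤t N = begin
    S a n₂ * S b n₂ + S a n * S a n          ≤⟨ +-monoʳ-≤ _ (square-≤-triangle (term-nonneg 0≤t) (term-nonneg 0≤t) n n) ⟩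
    S a n₂ * S b n₂ + triangle a a n₂        ≤⟨ square-minus-triangle-≤ (term-nonneg 0≤t) (proj₂ ∘ term-neg-bounds 0≤t) {n₂} ℕₚ.≤-refl ⟩
    S a n₂ * S a n₂ + triangle a b n₂        ≈⟨ +-congˡ (triangle-≈1 t (N ℕ.+ n)) ⟩
    S a n₂ * S a n₂ + 1#                     ∎
    where
    open ≤-Reasoning
    a = term t
    b = term (- t)
    n = suc N
    n₂ = n ℕ.+ n

-- Passage to the limit: bounds on `exp` and `ln`.

module ExponentialBounds (em : ExcludedMiddle 0ℓ) (ℛ : Reals) where

  open Reals ℛ hiding (zero)
  open RealArithmetic ℛ
  open FiniteSums ℛ
  open Exponential ℛ
  open CauchyProduct ℛ
  open RingProperties ring using (-0#≈0#; -‿involutive)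

  ≮⇒≥ : ∀ {x y} → ¬ (x < y) → y ≤ x
  ≮⇒≥ {x} {y} x≮y with em {y ≤ x}
  ... | yes y≤x = y≤x
  ... | no  y≰x = contradiction (≰⇒> y≰x) x≮y

  private
    0<y-x : ∀ {x y} → x < y → 0# < y - x
    0<y-x {x} x<y = ≤-<-trans (≤-reflexive (sym (-‿inverseʳ x)))
      (<-≤-trans (+-mono-<-≤ x<y (≤-refl {x = - x})) ≤-refl)

  -- The bound is required only at cofinally many indices and up to `ε`, because for negative
  -- arguments it is established only along suitable even lengths.
  ⟶-≤ : ∀ {s l c} → s ⟶ l →
        (∀ ε → 0# < ε → ∀ N → ∃ λ m → N ℕ.≤ m × s m ≤ c + ε) → l ≤ c
  ⟶-≤ {s} {l} {c} s⟶l cofinal = ≮⇒≥ too-large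
    where
    0<3 : 0# < 2# + 1#
    0<3 = +-pos 0<2 0≤1
    sandwich : ∀ {ε x} → - ε ≤ x - l → x ≤ c + ε → (2# + 1#) * ε ≈ l - c → ε ≤ 0#
    sandwich {ε} {x} lower upper 3ε≈ = 0≤y-x⇒x≤y (begin
      0#                                     ≤⟨ +-nonneg (x≤y⇒0≤y-x lower) (x≤y⇒0≤y-x upper) ⟩
      (x - l - (- ε)) + (c + ε - x)          ≈⟨ solve 4 (λ s l e c → (s :- l :- (:- e)) :+ (c :+ e :- s)
                                                   := (e :+ e) :- (l :- c)) refl x l ε c ⟩
      (ε + ε) - (l - c)                      ≈⟨ +-congˡ (-‿cong 3ε≈) ⟨
      (ε + ε) - (2# + 1#) * ε                ≈⟨ solve 1 (λ e → (e :+ e) :- (:1 :+ :1 :+ :1) :* e := con (+ 0) :- e) refl ε ⟩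
      0# - ε                                 ∎)
      where open ≤-Reasoning
    too-large : ¬ (c < l)
    too-large c<l = <⇒≱ 0<ε (sandwich {ε} {s m} (proj₁ (proj₂ near m (proj₁ (proj₂ witness))))
                                        (proj₂ (proj₂ witness)) (*-cancel-/ 0<3))
      where
      ε : ℝ
      -- A third of the excess: the two estimates at `m` would allow `l` to exceed `c` by at most
      -- `2 ε`.
      ε = (l - c) / (2# + 1#)
      0<ε : 0# < ε
      0<ε = /-pos (0<y-x c<l) 0<3
      near = s⟶l ε 0<ε
      witness = cofinal ε 0<ε (proj₁ near)
      m = proj₁ witness

  ≤-⟶ : ∀ {s l c} N → s ⟶ l → (∀ m → N ℕ.≤ m → c ≤ s m) → c ≤ l
  ≤-⟶ {s} {l} {c} N₀ s⟶l c≤s = ≮⇒≥ too-small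
    where
    sandwich : ∀ {ε x} → x - l ≤ ε → c ≤ x → 2# * ε ≈ c - l → ε ≤ 0#
    sandwich {ε} {x} upper lower 2ε≈ = 0≤y-x⇒x≤y (begin
      0#                                     ≤⟨ +-nonneg (x≤y⇒0≤y-x upper) (x≤y⇒0≤y-x lower) ⟩
      (ε - (x - l)) + (x - c)                ≈⟨ solve 4 (λ s l e c → (e :- (s :- l)) :+ (s :- c) := e :- (c :- l)) refl x l ε c ⟩
      ε - (c - l)                            ≈⟨ +-congˡ (-‿cong 2ε≈) ⟨
      ε - 2# * ε                             ≈⟨ solve 1 (λ e → e :- (:1 :+ :1) :* e := con (+ 0) :- e) refl ε ⟩
      0# - ε                                 ∎)
      where open ≤-Reasoning
    too-small : ¬ (l < c)
    too-small l<c = <⇒≱ 0<ε (sandwich {ε} {s m} (proj₂ (proj₂ near m (ℕₚ.m≤m+n _ N₀)))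
                                        (c≤s m (ℕₚ.m≤n+m N₀ _)) (*-cancel-/ 0<2))
      where
      ε : ℝ
      ε = (c - l) / 2#
      0<ε : 0# < ε
      0<ε = /-pos (0<y-x l<c) 0<2
      near = s⟶l ε 0<ε
      m = proj₁ near ℕ.+ N₀

  expSeries≤exp : ∀ {x} → 0# ≤ x → ∀ M → expSeries x M ≤ exp x
  expSeries≤exp 0≤x M = ≤-⟶ M (exp-series _) λ m M≤m → S-mono (term-nonneg 0≤x) M≤m

  exp-≤ : ∀ {x c} → (∀ M → expSeries x M ≤ c) → exp x ≤ c
  exp-≤ {x} E≤c = ⟶-≤ (exp-series x) λ ε 0<ε N →
    N , ℕₚ.≤-refl , ≤-trans (E≤c N) (x≤x+y (<⇒≤ 0<ε))

  exp-mono-≤ : ∀ {x y} → 0# ≤ x → x ≤ y → exp x ≤ exp y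
  exp-mono-≤ {x} {y} 0≤x x≤y = exp-≤ λ M →
    ≤-trans (sum-mono-≤ {M} (term-mono 0≤x x≤y ∘ toℕ)) (expSeries≤exp (≤-trans 0≤x x≤y) M)

  1≤exp : ∀ {x} → 0# ≤ x → 1# ≤ exp x
  1≤exp {x} 0≤x = ≤-trans (≤-reflexive (sym (trans (+-identityʳ _) (term-zero x)))) (expSeries≤exp 0≤x 1)

  1<e : 1# < e
  1<e = <-≤-trans (≤-<-trans (≤-reflexive (sym (+-identityʳ 1#))) (+-mono-≤-< ≤-refl 0<1))
    (≤-trans (≤-reflexive (sym two)) (expSeries≤exp 0≤1 2))
    where
    open ≈-Reasoning
    two : expSeries 1# 2 ≈ 2#
    two = +-cong (term-zero 1#) (trans (+-identityʳ _) (begin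
      term 1# 1            ≈⟨ trans (*-congʳ (+-identityʳ 1#)) (*-identityˡ _) ⟨
      fromℕ 1 * term 1# 1  ≈⟨ term-suc 1# 0 ⟩
      1# * term 1# 0       ≈⟨ trans (*-identityˡ _) (term-zero 1#) ⟩
      1#                   ∎))

  -- With `A₁`, `A₂` the partial sums at `t = - x` of lengths `n` and `n + n`, and `B` the one at
  -- `x` of length `n + n`, `expSeries-neg-≤` reads `A₂ B ≤ 1 + A₂² - A₁²`. The difference of
  -- squares tends to 0, and `A₂ ≥ 1`.
  exp-nonpos-≤1 : ∀ {x} → x ≤ 0# → exp x ≤ 1#
  exp-nonpos-≤1 {x} x≤0 = ⟶-≤ (exp-series x) small
    where
    t = - x
    s = exp t
    0≤t : 0# ≤ t
    0≤t = ≤-respˡ -0#≈0# (neg-mono-≤ x≤0)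
    0<s+s : 0# < s + s
    0<s+s = +-pos 0<s (<⇒≤ 0<s)
      where 0<s = <-≤-trans 0<1 (1≤exp 0≤t)
    small : ∀ ε → 0# < ε → ∀ N → ∃ λ m → N ℕ.≤ m × expSeries x m ≤ 1# + ε
    small ε 0<ε N = n₂ , ℕₚ.≤-trans (ℕₚ.m≤m+n N N₁) (ℕₚ.≤-trans (ℕₚ.n≤1+n N′) (ℕₚ.m≤m+n n n)) , B≤1+ε
      where
      open ≤-Reasoning
      -- The tolerance is `ε` divided by a bound for `A₂ + A₁`, so that `(A₂ - A₁) * (A₂ + A₁)`
      -- stays below `ε`.
      near = exp-series t (ε / (s + s)) (/-pos 0<ε 0<s+s)
      N₁ = proj₁ near
      close = proj₂ near
      N′ = N ℕ.+ N₁
      n = suc N′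
      n₂ = n ℕ.+ n
      η = ε / (s + s)
      A₁ = expSeries t n
      A₂ = expSeries t n₂
      B = expSeries x n₂
      B≈ : expSeries (- t) n₂ ≈ B
      B≈ = sum-cong-≋ {n = n₂} (term-cong (-‿involutive x) ∘ toℕ)
      A₂-A₁≤η : A₂ - A₁ ≤ η
      A₂-A₁≤η = begin
        A₂ - A₁     ≤⟨ +-monoˡ-≤ _ (expSeries≤exp 0≤t n₂) ⟩
        s - A₁      ≤⟨ x+z≈y⇒x≤y (x≤y⇒0≤y-x (proj₁ (close n (ℕₚ.≤-trans (ℕₚ.m≤n+m N₁ N) (ℕₚ.n≤1+n N′)))))
                         (solve 3 (λ s a η → (s :- a) :+ (a :- s :- (:- η)) := η) refl s A₁ η) ⟩
        η           ∎
      A₂*B≤ : A₂ * B ≤ 1# + ε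
      A₂*B≤ = begin
        A₂ * B                                       ≈⟨ *-congˡ B≈ ⟨
        A₂ * expSeries (- t) n₂                      ≤⟨ x+z≈y⇒x≤y (x≤y⇒0≤y-x (expSeries-neg-≤ 0≤t N′))
                                                          (solve 4 (λ a b A o → A :* b :+ (A :* A :+ o :- (A :* b :+ a :* a))
                                                            := (A :- a) :* (A :+ a) :+ o) refl A₁ (expSeries (- t) n₂) A₂ 1#) ⟩
        (A₂ - A₁) * (A₂ + A₁) + 1#                   ≤⟨ +-monoˡ-≤ _ (*-mono-≤ (<⇒≤ (/-pos 0<ε 0<s+s))
                                                          (+-nonneg (S-nonneg (term-nonneg 0≤t) n₂) (S-nonneg (term-nonneg 0≤t) n))
                                                          A₂-A₁≤η (+-mono-≤ (expSeries≤exp 0≤t n₂) (expSeries≤exp 0≤t n))) ⟩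
        η * (s + s) + 1#                             ≈⟨ +-congʳ (trans (*-comm _ _) (*-cancel-/ 0<s+s)) ⟩
        ε + 1#                                       ≈⟨ +-comm _ _ ⟩
        1# + ε                                       ∎
      1≤A₂ : 1# ≤ A₂
      1≤A₂ = ≤-trans (≤-reflexive (sym (trans (+-identityʳ _) (term-zero t))))
                     (S-mono (term-nonneg 0≤t) {1} {n₂} (ℕ.s≤s ℕ.z≤n))
      B≤1+ε : B ≤ 1# + ε
      B≤1+ε = 1≤a∧a*b≤c⇒b≤c 1≤A₂ (+-nonneg 0≤1 (<⇒≤ 0<ε)) A₂*B≤

  -- By contraposition: a nonpositive logarithm would force `y ≈ exp (ln y) ≤ 1`.
  ln-pos : ∀ {y} → 1# < y → 0# < ln y
  ln-pos 1<y = ≰⇒> λ ln≤0 → <⇒≱ 1<y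
    (≤-respˡ (exp-ln (≤-<-trans 0≤1 1<y)) (exp-nonpos-≤1 ln≤0))

  exp-cancel-< : ∀ {x y} → 0# ≤ y → exp x < exp y → x < y
  exp-cancel-< 0≤y p = ≰⇒> λ y≤x → <⇒≱ p (exp-mono-≤ 0≤y y≤x)

  -- The limit is taken in the form `exp l ≤ 1 / Π`, which requires a positive product `Π`;
  -- otherwise the left side is at most 0.
  product-*-exp-≤1 : ∀ {n} (f : Fin n → ℝ) → (∀ i → 0# ≤ f i) → (∀ i → f i ≤ 1#) →
                     ∀ {l} → 0# ≤ l → l ≤ sum f → product (λ i → 1# - f i) * exp l ≤ 1#
  product-*-exp-≤1 f 0≤f f≤1 {l} 0≤l l≤Σf with em {0# < product (λ i → 1# - f i)}
  ... | no  Π≯0 = ≤-trans (*-monoʳ-≤ (≤-trans 0≤1 (1≤exp 0≤l)) (≮⇒≥ Π≯0)) (≤-respˡ (sym (zeroˡ _)) 0≤1)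
  ... | yes 0<Π = ≤-respʳ (*-cancel-/ 0<Π) (*-monoˡ-≤ (<⇒≤ 0<Π) (exp-≤ λ M →
    *-cancelˡ-≤ 0<Π (≤-trans (*-monoˡ-≤ (<⇒≤ 0<Π) (sum-mono-≤ {M} (term-mono 0≤l l≤Σf ∘ toℕ)))
      (≤-respʳ (sym (*-cancel-/ 0<Π)) (product-*-expSeries-≤1 f 0≤f f≤1 M)))))

-- The numerical conditions on β and k, and the probability budget of a window.

module Threshold (em : ExcludedMiddle 0ℓ) (ℛ : Reals) (β k : ℕ) where

  open Reals ℛ hiding (zero)
  open RealArithmetic ℛ
  open ExponentialBounds em ℛ

  private
    b κ g B L : ℝ
    b = fromℕ β
    κ = fromℕ k
    g = 1# - 1# / e
    B = fromℕ 2 / g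
    L = ln (δ β k)

  threshold : ℝ
  threshold = 2# * L

  0<e : 0# < e
  0<e = ≤-<-trans 0≤1 1<e

  0<g : 0# < g
  0<g = ≰⇒> λ g≤0 → <⇒≱ 1<e (≤-respˡ (*-identityʳ e) (≤-respʳ (*-cancel-/ 0<e) (*-monoˡ-≤ (<⇒≤ 0<e)
    (0≤y-x⇒x≤y (x+z≈y⇒x≤y (x≤y⇒0≤y-x g≤0)
      (solve 1 (λ i → con (+ 0) :+ (con (+ 0) :- (:1 :- i)) := i :- :1) refl (1# / e)))))))

  g≤1 : g ≤ 1#
  g≤1 = x+z≈y⇒x≤y (<⇒≤ (/-pos 0<1 0<e)) (solve 1 (λ i → (:1 :- i) :+ i := :1) refl (1# / e))

  0<fromℕ2 : 0# < fromℕ 2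
  0<fromℕ2 = fromℕ-pos {2} (ℕ.s≤s ℕ.z≤n)

  1<fromℕ2 : 1# < fromℕ 2
  1<fromℕ2 = <-≤-trans (≤-<-trans (≤-reflexive (sym (+-identityʳ 1#))) (+-mono-≤-< ≤-refl 0<1))
    (≤-reflexive (sym fromℕ2≈2))

  1<B : 1# < B
  1<B = ≰⇒> λ B≤1 → <⇒≱ 1<fromℕ2 (≤-respˡ (*-cancel-/ 0<g)
    (≤-trans (*-monoˡ-≤ (<⇒≤ 0<g) B≤1) (≤-respˡ (sym (*-identityʳ g)) g≤1)))

  0<g^2 : 0# < g ^ 2
  0<g^2 = <-≤-trans (*-pos 0<g 0<g) (≤-reflexive (sym (x^2≈x*x g)))

  1≤ξ : 1# ≤ ξ
  1≤ξ = *-cancelˡ-≤ 0<g^2 (begin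
    g ^ 2 * 1#     ≈⟨ *-identityʳ _ ⟩
    g ^ 2          ≈⟨ x^2≈x*x g ⟩
    g * g          ≤⟨ *-mono-≤ 0≤1 (<⇒≤ 0<g) g≤1 g≤1 ⟩
    1# * 1#        ≈⟨ *-identityʳ 1# ⟩
    1#             ≤⟨ <⇒≤ 1<fromℕ2 ⟩
    fromℕ 2        ≈⟨ *-cancel-/ 0<g^2 ⟨
    g ^ 2 * ξ      ∎)
    where open ≤-Reasoning

  0<ξ : 0# < ξ
  0<ξ = <-≤-trans 0<1 1≤ξ

  module _ (0<β : 0 ℕ.< β) (0<k : 0 ℕ.< k) (large : pow B (ξ / e) < κ) where

    private
      K : ℝ
      K = pow κ (e / ξ)

    -- The lower bound on `k` with its exponent inverted: on logarithms, multiply by `e / ξ`.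
    B≤K : B ≤ K
    B≤K = ≤-respˡ (exp-ln (≤-<-trans 0≤1 1<B)) (exp-mono-≤ (<⇒≤ (ln-pos 1<B)) lnB≤)
      where
      1<κ : 1# < κ
      1<κ = ≤-<-trans (1≤exp (*-nonneg (<⇒≤ (/-pos 0<ξ 0<e)) (<⇒≤ (ln-pos 1<B)))) large
      ξ/e*lnB≤lnκ : ξ / e * ln B ≤ ln κ
      ξ/e*lnB≤lnκ = <⇒≤ (exp-cancel-< (<⇒≤ (ln-pos 1<κ))
        (<-≤-trans large (≤-reflexive (sym (exp-ln (≤-<-trans 0≤1 1<κ))))))
      lnB≤ : ln B ≤ e / ξ * ln κ
      lnB≤ = begin
        ln B                              ≈⟨ trans (*-congʳ (*-identityʳ 1#)) (*-identityˡ _) ⟨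
        (1# * 1#) * ln B                  ≈⟨ *-congʳ (*-cong (*-inverse-pos 0<e) (*-inverse-pos 0<ξ)) ⟨
        ((e * e ⁻¹) * (ξ * ξ ⁻¹)) * ln B  ≈⟨ solve 5 (λ e i x j l → ((e :* i) :* (x :* j)) :* l := (e :* j) :* ((x :* i) :* l)) refl e (e ⁻¹) ξ (ξ ⁻¹) (ln B) ⟩
        e / ξ * (ξ / e * ln B)            ≤⟨ *-monoˡ-≤ (<⇒≤ (/-pos 0<e 0<ξ)) ξ/e*lnB≤lnκ ⟩
        e / ξ * ln κ                      ∎
        where open ≤-Reasoning

    private
      1≤b : 1# ≤ b
      1≤b = 1≤fromℕ 0<β

      b≤b^2 : b ≤ b ^ 2
      b≤b^2 = ≤-respˡ (*-identityˡ b) (≤-respʳ (sym (x^2≈x*x b)) (*-monoʳ-≤ (≤-trans 0≤1 1≤b) 1≤b))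

    1<δ : 1# < δ β k
    1<δ = <-≤-trans (<-≤-trans 1<B B≤K) (≤-respˡ (*-identityˡ K) (*-monoʳ-≤ 0≤K (≤-trans 1≤b b≤b^2)))
      where
      0≤K : 0# ≤ K
      0≤K = <⇒≤ (<-≤-trans (≤-<-trans 0≤1 1<B) B≤K)

    0<δ : 0# < δ β k
    0<δ = ≤-<-trans 0≤1 1<δ

    0<L : 0# < ln (δ β k)
    0<L = ln-pos 1<δ

    0≤threshold : 0# ≤ threshold
    0≤threshold = <⇒≤ (*-pos 0<2 0<L)

    private
      -- One factor β of `δ` pays for the β slots, and `K ≥ B = 2 / g` for the factor 2; this is
      -- where the constant 2/(1 - 1/e) comes from.
      collision-≤ : b * (2# * δ β k ⁻¹) ≤ g
      collision-≤ = *-cancelˡ-≤ 0<δ (begin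
        δ β k * (b * (2# * δ β k ⁻¹)) ≈⟨ solve 4 (λ d b t i → d :* (b :* (t :* i)) := (b :* t) :* (d :* i)) refl (δ β k) b 2# (δ β k ⁻¹) ⟩
        (b * 2#) * (δ β k * δ β k ⁻¹) ≈⟨ trans (*-congˡ (*-inverse-pos 0<δ)) (*-identityʳ _) ⟩
        b * 2#                        ≤⟨ *-monoʳ-≤ (<⇒≤ 0<2) b≤b^2 ⟩
        b ^ 2 * 2#                    ≈⟨ *-congˡ fromℕ2≈2 ⟨
        b ^ 2 * fromℕ 2               ≈⟨ *-congˡ (*-cancel-/ 0<g) ⟨
        b ^ 2 * (g * B)               ≤⟨ *-monoˡ-≤ (≤-trans (≤-trans 0≤1 1≤b) b≤b^2) (*-monoˡ-≤ (<⇒≤ 0<g) B≤K) ⟩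
        b ^ 2 * (g * K)               ≈⟨ solve 3 (λ b g K → b :* (g :* K) := (b :* K) :* g) refl (b ^ 2) g K ⟩
        δ β k * g                     ∎)
        where open ≤-Reasoning

    module _ (short : b < κ / (fromℕ 2 * e * Γ β k)) where

      private
        0<κ : 0# < κ
        0<κ = fromℕ-pos 0<k
        D v : ℝ
        D = fromℕ 2 * e * Γ β k
        v = b * threshold / κ
        0<D : 0# < D
        0<D = *-pos (*-pos 0<fromℕ2 0<e) (*-pos 0<ξ 0<L)
        0≤v : 0# ≤ v
        0≤v = *-nonneg (*-nonneg (≤-trans 0≤1 1≤b) 0≤threshold) (<⇒≤ (⁻¹-pos 0<κ))

        e*v<1 : e * v < 1#
        e*v<1 = *-cancelˡ-< (<⇒≤ 0<κ) (begin-strict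
          -- Inserting the factor `ξ ≥ 1` makes `Γ = ξ ln δ` appear, so that the bound on β applies.
          κ * (e * v)                ≤⟨ *-monoˡ-≤ (<⇒≤ 0<κ) (*-monoˡ-≤ (<⇒≤ 0<e) (≤-respˡ (*-identityˡ v) (*-monoʳ-≤ 0≤v 1≤ξ))) ⟩
          κ * (e * (ξ * v))          ≈⟨ solve 4 (λ κ e x v → κ :* (e :* (x :* v)) := (e :* x) :* (κ :* v)) refl κ e ξ v ⟩
          (e * ξ) * (κ * v)          ≈⟨ *-congˡ (*-cancel-/ 0<κ) ⟩
          (e * ξ) * (b * (2# * L))   ≈⟨ solve 5 (λ e x b t L → (e :* x) :* (b :* (t :* L)) := (t :* e :* (x :* L)) :* b) refl e ξ b 2# L ⟩
          (2# * e * (ξ * L)) * b     ≈⟨ *-congʳ (*-congʳ (*-congʳ fromℕ2≈2)) ⟨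
          D * b                      <⟨ *-monoˡ-< 0<D short ⟩
          D * (κ / D)                ≈⟨ *-cancel-/ 0<D ⟩
          κ                          ≈⟨ *-identityʳ κ ⟨
          κ * 1#                     ∎)
          where open ≤-Reasoning

      window-budget<1 : b * (2# * δ β k ⁻¹) + b * threshold / κ < 1#
      window-budget<1 = <-≤-trans (+-mono-≤-< collision-≤ v<1/e)
        (≤-reflexive (solve 1 (λ i → (:1 :- i) :+ i := :1) refl (1# / e)))
        where
        v<1/e : v < 1# / e
        v<1/e = *-cancelˡ-< (<⇒≤ 0<e) (<-≤-trans e*v<1 (≤-reflexive (sym (*-cancel-/ 0<e))))

-- Independent transmissions: sums over all sets of transmitters.

module SubsetSums (em : ExcludedMiddle 0ℓ) (ℛ : Reals) where

  open Reals ℛ hiding (zero)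
  open RealArithmetic ℛ
  open FiniteSums ℛ
  open ExponentialBounds em ℛ
  open Geocast em ℛ using (Σ-subsets)

  Σ-subsets-mono : ∀ n {f g : Subset n → ℝ} → (∀ τ → f τ ≤ g τ) → Σ-subsets n f ≤ Σ-subsets n g
  Σ-subsets-mono zero    f≤g = f≤g []
  Σ-subsets-mono (suc n) f≤g = +-mono-≤ (Σ-subsets-mono n (f≤g ∘ (true ∷_))) (Σ-subsets-mono n (f≤g ∘ (false ∷_)))

  Σ-subsets-cong : ∀ n {f g : Subset n → ℝ} → (∀ τ → f τ ≈ g τ) → Σ-subsets n f ≈ Σ-subsets n g
  Σ-subsets-cong zero    f≈g = f≈g []
  Σ-subsets-cong (suc n) f≈g = +-cong (Σ-subsets-cong n (f≈g ∘ (true ∷_))) (Σ-subsets-cong n (f≈g ∘ (false ∷_)))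

  Σ-subsets-+ : ∀ n (f g : Subset n → ℝ) → Σ-subsets n (λ τ → f τ + g τ) ≈ Σ-subsets n f + Σ-subsets n g
  Σ-subsets-+ zero    f g = refl
  Σ-subsets-+ (suc n) f g = trans
    (+-cong (Σ-subsets-+ n (f ∘ (true ∷_)) (g ∘ (true ∷_))) (Σ-subsets-+ n (f ∘ (false ∷_)) (g ∘ (false ∷_))))
    (solve 4 (λ a b c d → (a :+ b) :+ (c :+ d) := (a :+ c) :+ (b :+ d)) refl _ _ _ _)

  Σ-subsets-*ˡ : ∀ n c (f : Subset n → ℝ) → Σ-subsets n (λ τ → c * f τ) ≈ c * Σ-subsets n f
  Σ-subsets-*ˡ zero    c f = refl
  Σ-subsets-*ˡ (suc n) c f = trans
    (+-cong (Σ-subsets-*ˡ n c (f ∘ (true ∷_))) (Σ-subsets-*ˡ n c (f ∘ (false ∷_)))) (sym (distribˡ _ _ _))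

  sum-Σ-subsets : ∀ {m} n (f : Fin m → Subset n → ℝ) →
                  sum (λ i → Σ-subsets n (f i)) ≈ Σ-subsets n (λ τ → sum (λ i → f i τ))
  sum-Σ-subsets zero    f = refl
  sum-Σ-subsets {m} (suc n) f = trans (∑-distrib-+ {m} _ _)
    (+-cong (sum-Σ-subsets n λ i → f i ∘ (true ∷_)) (sum-Σ-subsets n λ i → f i ∘ (false ∷_)))

  weight : ∀ {n} → (Fin n → ℝ) → (Fin n → ℝ) → Subset n → ℝ
  weight {n} a b τ = product {n} λ i → if lookup τ i then a i else b i

  -- Expanding the product chooses, for each node, to transmit or not. Total probability, marginals
  -- and the expectation of 2^-N are all instances.
  Σ-weight : ∀ {n} (a b : Fin n → ℝ) → Σ-subsets n (weight a b) ≈ product (λ i → a i + b i)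
  Σ-weight {zero}  a b = refl
  Σ-weight {suc n} a b = begin
    Σ-subsets n (λ τ → a₀ * weight a′ b′ τ) + Σ-subsets n (λ τ → b₀ * weight a′ b′ τ)
      ≈⟨ +-cong (Σ-subsets-*ˡ n a₀ (weight a′ b′)) (Σ-subsets-*ˡ n b₀ (weight a′ b′)) ⟩
    a₀ * Σ-subsets n (weight a′ b′) + b₀ * Σ-subsets n (weight a′ b′)
      ≈⟨ distribʳ _ _ _ ⟨
    (a₀ + b₀) * Σ-subsets n (weight a′ b′)
      ≈⟨ *-congˡ (Σ-weight a′ b′) ⟩
    (a₀ + b₀) * product (λ i → a′ i + b′ i) ∎
    where
    open ≈-Reasoning
    a₀ = a Fin.zero
    b₀ = b Fin.zero
    a′ = a ∘ Fin.suc
    b′ = b ∘ Fin.suc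

  product-single : ∀ {n} {f : Fin n → ℝ} j → (∀ i → i ≢ j → f i ≈ 1#) → product f ≈ f j
  product-single Fin.zero    f≈1 = trans (*-congˡ (product-≈1 (λ i → f≈1 (Fin.suc i) λ ()))) (*-identityʳ _)
  product-single (Fin.suc j) f≈1 = trans (*-cong (f≈1 Fin.zero λ ())
    (product-single j λ i i≢j → f≈1 (Fin.suc i) (i≢j ∘ suc-injectiveᶠ))) (*-identityˡ _)

  indicator : Bool → ℝ
  indicator b = if b then 1# else 0#

  ½ : ℝ
  ½ = 2# ⁻¹

  2*½≈1 : 2# * ½ ≈ 1#
  2*½≈1 = *-inverse-pos 0<2

  ½^∣_∣ : ∀ {n} → Subset n → ℝ
  ½^∣ τ ∣ = weight (λ _ → ½) (λ _ → 1#) τ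

  ½^∣τ∣-nonneg : ∀ {n} (τ : Subset n) → 0# ≤ ½^∣ τ ∣
  ½^∣τ∣-nonneg τ = product-nonneg λ i → factor (lookup τ i)
    where
    factor : ∀ b → 0# ≤ (if b then ½ else 1#)
    factor true  = <⇒≤ (⁻¹-pos 0<2)
    factor false = 0≤1

  -- At most one transmitter means N ≤ 1, hence 2 · 2^-N ≥ 1. This is how the indicator of a
  -- successful heavy slot is dominated by a product over the nodes.
  lone⇒1≤2½^∣τ∣ : ∀ {n} (τ : Subset n) {j} → (∀ i → lookup τ i ≡ true → i ≡ j) → 1# ≤ 2# * ½^∣ τ ∣
  lone⇒1≤2½^∣τ∣ τ {j} lone = ≤-respˡ 2*½≈1 (*-monoˡ-≤ (<⇒≤ 0<2)
    (≤-respʳ (sym (product-single j factor≈1)) (½≤ (lookup τ j))))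
    where
    ½≤1 : ½ ≤ 1#
    ½≤1 = *-cancelˡ-≤ 0<2 (≤-respˡ (sym 2*½≈1) (≤-respʳ (sym (*-identityʳ 2#)) (x≤x+y 0≤1)))
    ½≤ : ∀ b → ½ ≤ (if b then ½ else 1#)
    ½≤ true  = ≤-refl
    ½≤ false = ½≤1
    factor≈1 : ∀ i → i ≢ j → (if lookup τ i then ½ else 1#) ≈ 1#
    factor≈1 i i≢j with lookup τ i in eq
    ... | true  = contradiction (lone i eq) i≢j
    ... | false = refl

  bernoulli : ∀ {n} → (Fin n → ℝ) → Subset n → ℝ
  bernoulli p = weight p (λ i → 1# - p i)

  bernoulli-cong : ∀ {n} {p q : Fin n → ℝ} → (∀ i → p i ≈ q i) → ∀ τ → bernoulli p τ ≈ bernoulli q τ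
  bernoulli-cong {n} {p} {q} p≈q τ = product-cong λ i → factor i (lookup τ i)
    where
    factor : ∀ i b → (if b then p i else 1# - p i) ≈ (if b then q i else 1# - q i)
    factor i true  = p≈q i
    factor i false = +-congˡ (-‿cong (p≈q i))

  Σ-bernoulli : ∀ {n} (p : Fin n → ℝ) → Σ-subsets n (bernoulli p) ≈ 1#
  Σ-bernoulli p = trans (Σ-weight p (λ i → 1# - p i))
    (product-≈1 λ i → solve 1 (λ p → p :+ (:1 :- p) := :1) refl (p i))

  expectation-const : ∀ {n} (p : Fin n → ℝ) c → Σ-subsets n (λ τ → bernoulli p τ * c) ≈ c
  expectation-const {n} p c = trans (Σ-subsets-cong n λ τ → *-comm _ _)
    (trans (Σ-subsets-*ˡ n c (bernoulli p)) (trans (*-congˡ (Σ-bernoulli p)) (*-identityʳ c)))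

  bernoulli-0 : ∀ {n} {p : Fin n → ℝ} τ i → p i ≈ 0# → lookup τ i ≡ true → bernoulli p τ ≈ 0#
  bernoulli-0 {p = p} τ i pi≈0 i∈τ = product-≈0 i (trans (reflexive (≡.cong (if_then p i else (1# - p i)) i∈τ)) pi≈0)

  -- Setting the weight of the choice that `u` is silent to 0 implements the indicator; the sum then
  -- factors.
  marginal : ∀ {n} (p : Fin n → ℝ) u →
             Σ-subsets n (λ τ → bernoulli p τ * indicator (lookup τ u)) ≈ p u
  marginal {n} p u = begin
    Σ-subsets n (λ τ → bernoulli p τ * indicator (lookup τ u)) ≈⟨ Σ-subsets-cong n restrict ⟩
    Σ-subsets n (weight p q)                                   ≈⟨ Σ-weight p q ⟩
    product (λ i → p i + q i)                                  ≈⟨ product-single u p+q≈1 ⟩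
    p u + q u                                                  ≈⟨ +-congˡ qu≈0 ⟩
    p u + 0#                                                   ≈⟨ +-identityʳ _ ⟩
    p u                                                        ∎
    where
    open ≈-Reasoning
    q : Fin n → ℝ
    q i = if does (i ≟ᶠ u) then 0# else 1# - p i
    qu≈0 : q u ≈ 0#
    qu≈0 with u ≟ᶠ u
    ... | yes _  = refl
    ... | no u≢u = contradiction ≡.refl u≢u
    p+q≈1 : ∀ i → i ≢ u → p i + q i ≈ 1#
    p+q≈1 i i≢u with i ≟ᶠ u
    ... | yes i≡u = contradiction i≡u i≢u
    ... | no _    = solve 1 (λ p → p :+ (:1 :- p) := :1) refl (p i)
    restrict : ∀ τ → bernoulli p τ * indicator (lookup τ u) ≈ weight p q τ
    restrict τ with lookup τ u in eq
    ... | false = trans (zeroʳ _)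
      (sym (product-≈0 u (trans (reflexive (≡.cong (if_then p u else q u) eq)) qu≈0)))
    ... | true  = trans (*-identityʳ _) (product-cong same)
      where
      same : ∀ i → (if lookup τ i then p i else 1# - p i) ≈ (if lookup τ i then p i else q i)
      same i with i ≟ᶠ u
      ... | no _ = refl
      ... | yes ≡.refl = trans (reflexive (≡.cong (if_then p i else (1# - p i)) eq))
                               (reflexive (≡.cong (if_then p i else 0#) (≡.sym eq)))

  module _ {n} {p : Fin n → ℝ} (0≤p : ∀ i → 0# ≤ p i) (p≤1 : ∀ i → p i ≤ 1#) where

    bernoulli-nonneg : ∀ τ → 0# ≤ bernoulli p τ
    bernoulli-nonneg τ = product-nonneg λ i → factor i (lookup τ i)
      where
      factor : ∀ i b → 0# ≤ (if b then p i else 1# - p i)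
      factor i true  = 0≤p i
      factor i false = x≤y⇒0≤y-x (p≤1 i)

    -- The comparison is demanded only where the probability is nonzero, since the invariants of the
    -- execution hold only after possible slots.
    expectation-mono : ∀ {f g : Subset n → ℝ} → (∀ τ → ¬ (bernoulli p τ ≈ 0#) → f τ ≤ g τ) →
                       Σ-subsets n (λ τ → bernoulli p τ * f τ) ≤ Σ-subsets n (λ τ → bernoulli p τ * g τ)
    expectation-mono {f} {g} f≤g = Σ-subsets-mono n pointwise
      where
      pointwise : ∀ τ → bernoulli p τ * f τ ≤ bernoulli p τ * g τ
      pointwise τ with em {bernoulli p τ ≈ 0#}
      ... | yes P≈0 = ≤-reflexive (trans (trans (*-congʳ P≈0) (zeroˡ _)) (sym (trans (*-congʳ P≈0) (zeroˡ _))))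
      ... | no P≉0  = *-monoˡ-≤ (bernoulli-nonneg τ) (f≤g τ P≉0)

    -- By Markov's inequality for 2^-N, where N is the number of transmitters.
    Σ-2½^∣τ∣-≤ : ∀ {l d} → 0# ≤ l → 2# * l ≤ sum p → 0# < d → exp l ≈ d →
                 Σ-subsets n (λ τ → bernoulli p τ * (2# * ½^∣ τ ∣)) ≤ 2# * d ⁻¹
    Σ-2½^∣τ∣-≤ {l} {d} 0≤l 2l≤Σp 0<d exp-l≈d = begin
      Σ-subsets n (λ τ → bernoulli p τ * (2# * ½^∣ τ ∣))
        ≈⟨ Σ-subsets-cong n (λ τ → solve 3 (λ b t w → b :* (t :* w) := t :* (b :* w)) refl _ _ _) ⟩
      Σ-subsets n (λ τ → 2# * (bernoulli p τ * ½^∣ τ ∣))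
        ≈⟨ Σ-subsets-*ˡ n 2# _ ⟩
      2# * Σ-subsets n (λ τ → bernoulli p τ * ½^∣ τ ∣)
        ≈⟨ *-congˡ (Σ-subsets-cong n λ τ → trans (product-*-distrib (λ i → if lookup τ i then p i else 1# - p i) (λ i → if lookup τ i then ½ else 1#))
                                                 (product-cong λ i → factor i (lookup τ i))) ⟩
      2# * Σ-subsets n (weight (λ i → p i * ½) (λ i → 1# - p i))
        ≈⟨ *-congˡ (Σ-weight (λ i → p i * ½) (λ i → 1# - p i)) ⟩
      2# * product (λ i → p i * ½ + (1# - p i))
        ≈⟨ *-congˡ (product-cong (λ i → halve (p i))) ⟩
      2# * product (λ i → 1# - p i * ½)
        ≤⟨ *-monoˡ-≤ (<⇒≤ 0<2) (*-cancelˡ-≤ 0<d (begin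
             d * product (λ i → 1# - p i * ½)     ≈⟨ *-comm _ _ ⟩
             product (λ i → 1# - p i * ½) * d     ≈⟨ *-congˡ exp-l≈d ⟨
             product (λ i → 1# - p i * ½) * exp l ≤⟨ product-*-exp-≤1 (λ i → p i * ½) (λ i → *-nonneg (0≤p i) (<⇒≤ 0<½)) p½≤1 0≤l l≤ ⟩
             1#                                   ≈⟨ *-inverse-pos 0<d ⟨
             d * d ⁻¹                             ∎)) ⟩
      2# * d ⁻¹ ∎
      where
      open ≤-Reasoning
      0<½ : 0# < ½
      0<½ = ⁻¹-pos 0<2
      x≈2x½ : ∀ x → x ≈ 2# * (x * ½)
      x≈2x½ x = sym (trans (solve 3 (λ t x h → t :* (x :* h) := x :* (t :* h)) refl 2# x ½) (trans (*-congˡ 2*½≈1) (*-identityʳ x)))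
      halve : ∀ x → x * ½ + (1# - x) ≈ 1# - x * ½
      halve x = trans (+-congˡ (+-congˡ (-‿cong (x≈2x½ x))))
        (solve 1 (λ y → y :+ (:1 :- (:1 :+ :1) :* y) := :1 :- y) refl (x * ½))
      p½≤1 : ∀ i → p i * ½ ≤ 1#
      p½≤1 i = ≤-trans (x≤x+y (*-nonneg (0≤p i) (<⇒≤ 0<½)))
        (≤-trans (≤-reflexive (trans (solve 1 (λ y → y :+ y := (:1 :+ :1) :* y) refl (p i * ½)) (sym (x≈2x½ (p i))))) (p≤1 i))
      l≤ : l ≤ sum (λ i → p i * ½)
      l≤ = *-cancelˡ-≤ 0<2 (≤-trans 2l≤Σp (≤-reflexive (trans (sum-cong-≋ {n = n} (λ i → x≈2x½ (p i)))
        (sym (*-distribˡ-sum {n} 2# (λ i → p i * ½))))))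
      factor : ∀ i b → (if b then p i else 1# - p i) * (if b then ½ else 1#) ≈ (if b then p i * ½ else 1# - p i)
      factor i true  = refl
      factor i false = *-identityʳ _

-- Positions, ranges and speeds.

module Geometry (em : ExcludedMiddle 0ℓ) (ℛ : Reals) (n : ℕ) (r Vmax : Reals.ℝ ℛ)
  (0<r : Reals._<_ ℛ (Reals.0# ℛ) r) (0<Vmax : Reals._<_ ℛ (Reals.0# ℛ) Vmax) where

  open Reals ℛ hiding (zero)
  open RealArithmetic ℛ
  open Geocast em ℛ using (Point; dist; _≈ₚ_)

  private
    half : ℝ
    half = 2# ⁻¹

    2*half≈1 : 2# * half ≈ 1#
    2*half≈1 = *-inverse-pos 0<2

    0<half : 0# < half
    0<half = ⁻¹-pos 0<2

    half≤1 : half ≤ 1#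
    half≤1 = *-cancelˡ-≤ 0<2 (≤-respˡ (sym 2*half≈1) (≤-respʳ (sym (*-identityʳ 2#)) (x≤x+y 0≤1)))

    16# : ℝ
    16# = (2# * 2#) * (2# * 2#)

    0<16 : 0# < 16#
    0<16 = *-pos (*-pos 0<2 0<2) (*-pos 0<2 0<2)

    -- The 16 is the largest excursion factor 2 times `8 η`, the greatest speed of the excursion
    -- `w`.
    scale : ∃ λ η → (0# < η) × (η ≤ r) × (16# * η ≤ Vmax)
    scale with total r (Vmax / 16#)
    ... | inj₁ r≤ = r , 0<r , ≤-refl ,
                    ≤-trans (*-monoˡ-≤ (<⇒≤ 0<16) r≤) (≤-reflexive (*-cancel-/ 0<16))
    ... | inj₂ ≤r = Vmax / 16# , /-pos 0<Vmax 0<16 , ≤r , ≤-reflexive (*-cancel-/ 0<16)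

  η : ℝ
  η = proj₁ scale

  private
    0<η : 0# < η
    0<η = proj₁ (proj₂ scale)

    0≤η : 0# ≤ η
    0≤η = <⇒≤ 0<η

    η≤r : η ≤ r
    η≤r = proj₁ (proj₂ (proj₂ scale))

    16η≤Vmax : 16# * η ≤ Vmax
    16η≤Vmax = proj₂ (proj₂ (proj₂ scale))

    0<1+n : 0# < fromℕ (suc n)
    0<1+n = fromℕ-pos {suc n} (ℕ.s≤s ℕ.z≤n)

  -- Clusters are X apart and nodes of a cluster are spread over a height of
  -- at most η; X + η is the range of transmission.
  X ε : ℝ
  X = r - η
  ε = η / fromℕ (suc n)

  0<ε : 0# < ε
  0<ε = /-pos 0<η 0<1+n

  0≤X : 0# ≤ X
  0≤X = x≤y⇒0≤y-x η≤r

  -- The excursion starts and ends at home and reaches 2 η halfway through the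
  -- slot, more than the η by which a link is in range.
  w : ℝ → ℝ
  w u = (2# * 2# * 2# * η) * (u * (1# - u))

  -- `m` is the cluster and `q` the excursion factor. All motion is horizontal and each node has a
  -- height of its own, so nodes never meet.
  pos : ℕ → ℕ → Fin n → ℝ → Point
  pos m q i u = fromℕ m * X + fromℕ q * w u , fromℕ (toℕ i) * ε

  w-at-0 : w 0# ≈ 0#
  w-at-0 = solve 1 (λ η → ((:1 :+ :1) :* (:1 :+ :1) :* (:1 :+ :1) :* η) :* (con (+ 0) :* (:1 :- con (+ 0))) := con (+ 0)) refl η

  w-at-1 : w 1# ≈ 0#
  w-at-1 = solve 1 (λ η → ((:1 :+ :1) :* (:1 :+ :1) :* (:1 :+ :1) :* η) :* (:1 :* (:1 :- :1)) := con (+ 0)) refl η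

  private
    w-at-half : w half ≈ 2# * η
    w-at-half = begin
      w half                                            ≈⟨ solve 2 (λ η h → ((:1 :+ :1) :* (:1 :+ :1) :* (:1 :+ :1) :* η) :* (h :* (:1 :- h))
                                                             := (:1 :+ :1) :* η :* (((:1 :+ :1) :* h) :* ((:1 :+ :1) :- (:1 :+ :1) :* h))) refl η half ⟩
      2# * η * ((2# * half) * (2# - 2# * half))         ≈⟨ *-congˡ (*-cong 2*half≈1 (+-congˡ (-‿cong 2*half≈1))) ⟩
      2# * η * (1# * (2# - 1#))                         ≈⟨ solve 1 (λ η → (:1 :+ :1) :* η :* (:1 :* ((:1 :+ :1) :- :1)) := (:1 :+ :1) :* η) refl η ⟩
      2# * η                                            ∎
      where open ≈-Reasoning

  pos-continuous : ∀ m q q′ i → pos m q i 1# ≈ₚ pos m q′ i 0#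
  pos-continuous m q q′ i =
    +-congˡ (trans (trans (*-congˡ w-at-1) (zeroʳ _)) (sym (trans (*-congˡ w-at-0) (zeroʳ _)))) , refl

  private
    fromℕ≉ : ∀ {a b} → a ℕ.< b → ¬ (fromℕ a * ε ≈ fromℕ b * ε)
    fromℕ≉ {a} {b} a<b eq = <⇒≱ (≤-<-trans (≤-reflexive (sym (+-identityʳ (fromℕ a)))) (+-mono-≤-< ≤-refl 0<1))
      (≤-trans (≤-reflexive (+-comm (fromℕ a) 1#)) (≤-trans (fromℕ-mono-≤ a<b)
        (*-cancelˡ-≤ 0<ε (≤-reflexive (trans (*-comm _ _) (trans (sym eq) (*-comm _ _)))))))

  pos-distinct : ∀ {m q m′ q′ i j u} → i ≢ j → ¬ (pos m q i u ≈ₚ pos m′ q′ j u)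
  pos-distinct {i = i} {j} i≢j (_ , y≈y′) with ℕₚ.<-cmp (toℕ i) (toℕ j)
  ... | tri< i<j _ _ = fromℕ≉ i<j y≈y′
  ... | tri≈ _ i≡j _ = i≢j (toℕ-injective i≡j)
  ... | tri> _ _ j<i = fromℕ≉ j<i (sym y≈y′)

  private
    square-cancel-≤ : ∀ {x y} → 0# ≤ y → x * x ≤ y * y → x ≤ y
    square-cancel-≤ {x} {y} 0≤y x²≤y² with total x y
    ... | inj₁ x≤y = x≤y
    ... | inj₂ y≤x with em {x ≤ y}
    ... | yes x≤y = x≤y
    ... | no  x≰y = contradiction x²≤y² (<⇒≱ (≤-<-trans (*-monoˡ-≤ 0≤y y≤x)
      (≤-<-trans (≤-reflexive (*-comm y x)) (*-monoˡ-< (≤-<-trans 0≤y (≰⇒> x≰y)) (≰⇒> x≰y)))))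

    square-mono : ∀ {a b} → - b ≤ a → a ≤ b → a * a ≤ b * b
    square-mono {a} {b} -b≤a a≤b = x+z≈y⇒x≤y (*-nonneg (x≤y⇒0≤y-x a≤b) (x≤y⇒0≤y-x -b≤a))
      (solve 2 (λ a b → a :* a :+ (b :- a) :* (a :- (:- b)) := b :* b) refl a b)

    ^2-sum-nonneg : ∀ a b → 0# ≤ a ^ 2 + b ^ 2
    ^2-sum-nonneg a b = +-nonneg (≤-respʳ (sym (x^2≈x*x a)) (square-nonneg a))
                                 (≤-respʳ (sym (x^2≈x*x b)) (square-nonneg b))

  dist-≤ : ∀ {x y x′ y′ l} → 0# ≤ l → (x - x′) * (x - x′) + (y - y′) * (y - y′) ≤ l * l →
           dist (x , y) (x′ , y′) ≤ l
  dist-≤ {x} {y} {x′} {y′} 0≤l le = square-cancel-≤ 0≤l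
    (≤-respˡ (sym (trans (√-square (^2-sum-nonneg (x - x′) (y - y′))) (+-cong (x^2≈x*x _) (x^2≈x*x _)))) le)

  dist-≰ : ∀ {x y x′ y′ l} → 0# ≤ l → l * l < (x - x′) * (x - x′) → ¬ (dist (x , y) (x′ , y′) ≤ l)
  dist-≰ {x} {y} {x′} {y′} {l} 0≤l lt d≤l = <⇒≱ lt (begin
    (x - x′) * (x - x′)                            ≤⟨ x≤x+y (square-nonneg (y - y′)) ⟩
    (x - x′) * (x - x′) + (y - y′) * (y - y′)      ≈⟨ +-cong (x^2≈x*x _) (x^2≈x*x _) ⟨
    (x - x′) ^ 2 + (y - y′) ^ 2                    ≈⟨ √-square nonneg ⟨
    √s * √s                                        ≤⟨ *-mono-≤ 0≤l (√-nonneg nonneg) d≤l d≤l ⟩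
    l * l                                          ∎)
    where
    open ≤-Reasoning
    nonneg = ^2-sum-nonneg (x - x′) (y - y′)
    √s = √ ((x - x′) ^ 2 + (y - y′) ^ 2)

  private
    0≤height : ∀ (i : Fin n) → 0# ≤ fromℕ (toℕ i) * ε
    0≤height i = *-nonneg (fromℕ-nonneg (toℕ i)) (<⇒≤ 0<ε)

    height≤η : ∀ (i : Fin n) → fromℕ (toℕ i) * ε ≤ η
    height≤η i = ≤-trans (*-monoʳ-≤ (<⇒≤ 0<ε) (fromℕ-mono-≤ (ℕₚ.m≤n⇒m≤1+n (ℕₚ.<⇒≤ (toℕ<n i)))))
                         (≤-reflexive (*-cancel-/ 0<1+n))

    height-diff : ∀ (i j : Fin n) → let d = fromℕ (toℕ i) * ε - fromℕ (toℕ j) * ε in d * d ≤ η * η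
    height-diff i j = square-mono
      (x+z≈y⇒x≤y (+-nonneg (0≤height i) (x≤y⇒0≤y-x (height≤η j)))
        (solve 3 (λ a b η → :- η :+ (a :+ (η :- b)) := a :- b) refl _ _ η))
      (x+z≈y⇒x≤y (+-nonneg (0≤height j) (x≤y⇒0≤y-x (height≤η i)))
        (solve 3 (λ a b η → (a :- b) :+ (b :+ (η :- a)) := η) refl _ _ η))

    0≤r : 0# ≤ r
    0≤r = <⇒≤ 0<r

    within : ∀ {dx dy} → dx * dx ≤ X * X → dy * dy ≤ η * η → dx * dx + dy * dy ≤ r * r
    within {dx} {dy} hx hy = ≤-trans (+-mono-≤ hx hy) (x+z≈y⇒x≤y (*-nonneg (*-nonneg (<⇒≤ 0<2) 0≤X) 0≤η)
      (solve 2 (λ r η → ((r :- η) :* (r :- η) :+ η :* η) :+ (:1 :+ :1) :* (r :- η) :* η := r :* r) refl r η))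

  InRange : (ℝ → Point) → (ℝ → Point) → Set
  InRange p q = ∀ u → 0# ≤ u → u ≤ 1# → dist (p u) (q u) ≤ r

  inRange-same : ∀ m q i j → InRange (pos m q i) (pos m q j)
  inRange-same m q i j u _ _ = dist-≤ 0≤r (within
    (≤-respˡ (solve 1 (λ x → con (+ 0) := (x :- x) :* (x :- x)) refl _) (square-nonneg X)) (height-diff i j))

  -- Equal excursion factors cancel, so the horizontal offset stays `X` throughout the slot, and
  -- `X² + η² ≤ (X + η)² = r²`.
  inRange-next : ∀ m q i j → InRange (pos m q i) (pos (suc m) q j)
  inRange-next m q i j u _ _ = dist-≤ 0≤r (within
    (≤-reflexive (solve 3 (λ m x a → (m :* x :+ a :- ((:1 :+ m) :* x :+ a)) :* (m :* x :+ a :- ((:1 :+ m) :* x :+ a)) := x :* x)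
      refl (fromℕ m) X (fromℕ q * w u))) (height-diff i j))

  inRange-prev : ∀ m q i j → InRange (pos (suc m) q i) (pos m q j)
  inRange-prev m q i j u _ _ = dist-≤ 0≤r (within
    (≤-reflexive (solve 3 (λ m x a → ((:1 :+ m) :* x :+ a :- (m :* x :+ a)) :* ((:1 :+ m) :* x :+ a :- (m :* x :+ a)) := x :* x)
      refl (fromℕ m) X (fromℕ q * w u))) (height-diff i j))

  private
    -- Evaluated halfway through the slot, where the farther cluster, with the larger factor, has
    -- gained at least `2 η` on the offset `X`. That makes `r + η`.
    module Gap {m m′ q q′ : ℕ} (m<m′ : m ℕ.< m′) (q<q′ : q ℕ.< q′) where

      x x′ : ℝ
      x = fromℕ m * X + fromℕ q * w half
      x′ = fromℕ m′ * X + fromℕ q′ * w half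

      0≤w : 0# ≤ w half
      0≤w = ≤-respʳ (sym w-at-half) (*-nonneg (<⇒≤ 0<2) 0≤η)

      r<x′-x : r < x′ - x
      r<x′-x = begin-strict
        r                                     ≈⟨ solve 2 (λ r η → r := (r :- η) :+ η) refl r η ⟩
        X + η                                 <⟨ +-mono-≤-< ≤-refl (<-≤-trans (≤-<-trans (≤-reflexive (sym (+-identityʳ η))) (+-mono-≤-< ≤-refl 0<η))
                                                   (≤-reflexive (solve 1 (λ η → η :+ η := (:1 :+ :1) :* η) refl η))) ⟩
        X + 2# * η                            ≈⟨ +-congˡ w-at-half ⟨
        X + w half                            ≈⟨ solve 4 (λ m q x w → x :+ w := ((:1 :+ m) :* x :+ (:1 :+ q) :* w) :- (m :* x :+ q :* w)) refl (fromℕ m) (fromℕ q) X (w half) ⟩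
        (fromℕ (suc m) * X + fromℕ (suc q) * w half) - x ≤⟨ +-monoˡ-≤ _ (+-mono-≤ (*-monoʳ-≤ 0≤X (fromℕ-mono-≤ m<m′)) (*-monoʳ-≤ 0≤w (fromℕ-mono-≤ q<q′))) ⟩
        x′ - x                                ∎
        where open ≤-Reasoning

      r²<[x′-x]² : r * r < (x′ - x) * (x′ - x)
      r²<[x′-x]² = ≤-<-trans (*-monoˡ-≤ 0≤r (<⇒≤ r<x′-x))
        (≤-<-trans (≤-reflexive (*-comm _ _)) (*-monoˡ-< (≤-<-trans 0≤r r<x′-x) r<x′-x))

  outOfRange-> : ∀ {m m′ q q′} i j → m ℕ.< m′ → q ℕ.< q′ → ¬ InRange (pos m′ q′ i) (pos m q j)
  outOfRange-> i j m<m′ q<q′ near = dist-≰ 0≤r (Gap.r²<[x′-x]² m<m′ q<q′) (near half (<⇒≤ 0<half) half≤1)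

  outOfRange-< : ∀ {m m′ q q′} i j → m ℕ.< m′ → q ℕ.< q′ → ¬ InRange (pos m q i) (pos m′ q′ j)
  outOfRange-< {m} {m′} {q} {q′} i j m<m′ q<q′ near = dist-≰ 0≤r
    (<-≤-trans (Gap.r²<[x′-x]² {m} {m′} {q} {q′} m<m′ q<q′)
      (≤-reflexive (solve 2 (λ a b → (b :- a) :* (b :- a) := (a :- b) :* (a :- b)) refl
        (Gap.x m<m′ q<q′) (Gap.x′ m<m′ q<q′))))
    (near half (<⇒≤ 0<half) half≤1)

  -- The displacement factors as `q * 8 η * (v - u) * (1 - u - v)` up to sign, and the last factor
  -- has absolute value at most 1.
  pos-speed : ∀ m {q} i u v → q ℕ.≤ 2 → 0# ≤ u → u ≤ v → v ≤ 1# →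
              dist (pos m q i u) (pos m q i v) ≤ Vmax * (v - u)
  pos-speed m {q} i u v q≤2 0≤u u≤v v≤1 = dist-≤ (*-nonneg (<⇒≤ 0<Vmax) 0≤z) (begin
    (x u - x v) * (x u - x v) + (y - y) * (y - y)   ≈⟨ solve 6 (λ a q c u v y → let xu = a :+ q :* (c :* (u :* (:1 :- u))) ; xv = a :+ q :* (c :* (v :* (:1 :- v))) in
                                                         (xu :- xv) :* (xu :- xv) :+ (y :- y) :* (y :- y)
                                                         := ((q :* c) :* (v :- u) :* (:1 :- u :- v)) :* ((q :* c) :* (v :- u) :* (:1 :- u :- v))) refl
                                                         (fromℕ m * X) (fromℕ q) c u v y ⟩
    (Q * z * s) * (Q * z * s)                       ≤⟨ square-mono lower upper ⟩
    (Vmax * z) * (Vmax * z)                         ∎)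
    where
    open ≤-Reasoning
    c = 2# * 2# * 2# * η
    Q = fromℕ q * c
    z = v - u
    s = 1# - u - v
    y = fromℕ (toℕ i) * ε
    x : ℝ → ℝ
    x u = fromℕ m * X + fromℕ q * w u
    0≤z : 0# ≤ z
    0≤z = x≤y⇒0≤y-x u≤v
    0≤c : 0# ≤ c
    0≤c = *-nonneg (*-nonneg (*-nonneg (<⇒≤ 0<2) (<⇒≤ 0<2)) (<⇒≤ 0<2)) 0≤η
    0≤Q : 0# ≤ Q
    0≤Q = *-nonneg (fromℕ-nonneg q) 0≤c
    Q≤Vmax : Q ≤ Vmax
    Q≤Vmax = ≤-trans (*-monoʳ-≤ 0≤c (fromℕ-mono-≤ q≤2)) (≤-trans (≤-reflexive (trans (*-congʳ fromℕ2≈2)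
      (solve 1 (λ η → let two = :1 :+ :1 in two :* (two :* two :* two :* η) := ((two :* two) :* (two :* two)) :* η) refl η))) 16η≤Vmax)
    0≤v : 0# ≤ v
    0≤v = ≤-trans 0≤u u≤v
    s≤1 : s ≤ 1#
    s≤1 = x+z≈y⇒x≤y (+-nonneg 0≤u 0≤v) (solve 2 (λ u v → (:1 :- u :- v) :+ (u :+ v) := :1) refl u v)
    -1≤s : - 1# ≤ s
    -1≤s = x+z≈y⇒x≤y (+-nonneg (x≤y⇒0≤y-x (≤-trans u≤v v≤1)) (x≤y⇒0≤y-x v≤1))
      (solve 2 (λ u v → :- :1 :+ ((:1 :- u) :+ (:1 :- v)) := :1 :- u :- v) refl u v)
    Qz≤ : Q * z ≤ Vmax * z
    Qz≤ = *-monoʳ-≤ 0≤z Q≤Vmax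
    upper : Q * z * s ≤ Vmax * z
    upper = ≤-trans (*-monoˡ-≤ (*-nonneg 0≤Q 0≤z) s≤1) (≤-trans (≤-reflexive (*-identityʳ _)) Qz≤)
    lower : - (Vmax * z) ≤ Q * z * s
    lower = ≤-trans (neg-mono-≤ Qz≤) (≤-trans (≤-reflexive (solve 1 (λ a → :- a := a :* (:- :1)) refl (Q * z)))
      (*-monoˡ-≤ (*-nonneg 0≤Q 0≤z) -1≤s))

  -- Cluster 1 is the middle one and contains the source. With everyone at home, both other clusters
  -- are within `r` of it, so all nodes are targets of the Geocast.
  initial-dist-≤ : ∀ {m} q q′ i j → m ℕ.≤ 2 → dist (pos m q i 0#) (pos 1 q′ j 0#) ≤ r
  initial-dist-≤ {m} q q′ i j m≤2 = dist-≤ 0≤r (within (≤-respˡ (*-cong home home) (apart m m≤2)) (height-diff i j))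
    where
    home : fromℕ m * X - fromℕ 1 * X ≈ (fromℕ m * X + fromℕ q * w 0#) - (fromℕ 1 * X + fromℕ q′ * w 0#)
    home = sym (+-cong (trans (+-congˡ (trans (*-congˡ w-at-0) (zeroʳ _))) (+-identityʳ _))
                       (-‿cong (trans (+-congˡ (trans (*-congˡ w-at-0) (zeroʳ _))) (+-identityʳ _))))
    :0 : ∀ {n} → Polynomial n
    :0 = con (+ 0)
    apart : ∀ m → m ℕ.≤ 2 → (fromℕ m * X - fromℕ 1 * X) * (fromℕ m * X - fromℕ 1 * X) ≤ X * X
    apart 0 _ = ≤-reflexive (solve 1 (λ x → let d = :0 :* x :- (:1 :+ :0) :* x in d :* d := x :* x) refl X)
    apart 1 _ = ≤-respˡ (solve 1 (λ x → let d = (:1 :+ :0) :* x :- (:1 :+ :0) :* x in :0 := d :* d) refl X) (square-nonneg X)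
    apart 2 _ = ≤-reflexive (solve 1 (λ x → let d = (:1 :+ (:1 :+ :0)) :* x :- (:1 :+ :0) :* x in d :* d := x :* x) refl X)
    apart (suc (suc (suc _))) (ℕ.s≤s (ℕ.s≤s ()))

-- The strategy of the adversary.

module Adversary (em : ExcludedMiddle 0ℓ) (ℛ : Reals) (n : ℕ) (P : Geocast.Protocol em ℛ n)
  (r Vmax : Reals.ℝ ℛ)
  (0<r : Reals._<_ ℛ (Reals.0# ℛ) r) (0<Vmax : Reals._<_ ℛ (Reals.0# ℛ) Vmax)
  (β k : ℕ) (0<k : 0 ℕ.< k) (k<n : k ℕ.< n)
  (θ : Reals.ℝ ℛ) (0≤θ : Reals._≤_ ℛ (Reals.0# ℛ) θ) where

  open Reals ℛ hiding (zero)
  open RealArithmetic ℛ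
  open FiniteSums ℛ
  open SubsetSums em ℛ
  open Geometry em ℛ n r Vmax 0<r 0<Vmax
  open Geocast em ℛ
  open Protocol P

  target : Fin n
  target = fromℕ< k<n

  toℕ-target : toℕ target ≡ k
  toℕ-target = toℕ-fromℕ< k<n

  src : Fin n
  src = fromℕ< (ℕₚ.<-trans 0<k k<n)

  src<k : toℕ src ℕ.< k
  src<k = ≡.subst (ℕ._< k) (≡.sym (toℕ-fromℕ< _)) 0<k

  data Side : Set where
    core middle rest : Side

  sideOf : ∀ {A B C : Set} → Tri A B C → Side
  sideOf (tri< _ _ _) = core
  sideOf (tri≈ _ _ _) = middle
  sideOf (tri> _ _ _) = rest

  side : Fin n → Side
  side i = sideOf (ℕₚ.<-cmp (toℕ i) k)

  side-core : ∀ {i} → toℕ i ℕ.< k → side i ≡ core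
  side-core {i} i<k with ℕₚ.<-cmp (toℕ i) k
  ... | tri< _ _ _   = ≡.refl
  ... | tri≈ i≮k _ _ = contradiction i<k i≮k
  ... | tri> i≮k _ _ = contradiction i<k i≮k

  side-middle : ∀ {i} → toℕ i ≡ k → side i ≡ middle
  side-middle {i} i≡k with ℕₚ.<-cmp (toℕ i) k
  ... | tri< _ i≢k _ = contradiction i≡k i≢k
  ... | tri≈ _ _ _   = ≡.refl
  ... | tri> _ i≢k _ = contradiction i≡k i≢k

  side-rest : ∀ {i} → k ℕ.< toℕ i → side i ≡ rest
  side-rest {i} k<i with ℕₚ.<-cmp (toℕ i) k
  ... | tri< _ _ k≮i = contradiction k<i k≮i
  ... | tri≈ _ _ k≮i = contradiction k<i k≮i
  ... | tri> _ _ _   = ≡.refl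

  clusterOf : Side → ℕ
  clusterOf middle = 0
  clusterOf core   = 1
  clusterOf rest   = 2

  cluster : Fin n → ℕ
  cluster i = clusterOf (side i)

  -- touch tells which core nodes stay at home during the slot, free whether
  -- the nodes beyond the target do.
  record Mode : Set where
    field
      touch : Fin n → Bool
      free  : Bool

  open Mode

  -- Out of range requires the farther cluster to have the strictly larger factor. The factor 2 thus
  -- separates the outer nodes from the core whether core nodes are at home or away.
  excursionOf : Side → Bool → Bool → ℕ
  excursionOf middle _ _ = 0
  excursionOf core   t _ = if t then 0 else 1
  excursionOf rest   _ f = if f then 0 else 2

  excursion : Mode → Fin n → ℕ
  excursion μ i = excursionOf (side i) (touch μ i) (free μ)

  excursion≤2 : ∀ s t f → excursionOf s t f ℕ.≤ 2
  excursion≤2 middle _     _     = ℕ.z≤n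
  excursion≤2 core   true  _     = ℕ.z≤n
  excursion≤2 core   false _     = ℕ.s≤s ℕ.z≤n
  excursion≤2 rest   _     true  = ℕ.z≤n
  excursion≤2 rest   _     false = ℕ.s≤s (ℕ.s≤s ℕ.z≤n)

  place : Mode → Fin n → ℝ → Point
  place μ i = pos (cluster i) (excursion μ i) i

  Linked : Mode → Fin n → Fin n → Set
  Linked μ i j = i ≢ j × InRange (place μ i) (place μ j)

  -- Reception has to be available before the MANET exists. The type repeats `Receives` as it
  -- unfolds for `manet`, including the trivial `i ∈ ⊤`, so that the two agree definitionally.
  Hears : Mode → Subset n → Fin n → Set
  Hears μ τ i = i ∈ ⊤ × i ∉ τ ×
    ∃ λ j → Linked μ i j × j ∈ τ × (∀ j′ → Linked μ i j′ → j′ ∈ τ → j′ ≡ j)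

  hears : Mode → Subset n → Fin n → Bool
  hears μ τ i = does (em {P = Hears μ τ i})

  schedule : ∀ {m} → History n m → Fin n → Vec Action m
  schedule []      i = []
  schedule (τ ∷ h) i = (if lookup τ i then T else R) ∷ schedule h i

  coreProbOf : Side → ℝ → ℝ
  coreProbOf core   p = p
  coreProbOf middle _ = 0#
  coreProbOf rest   _ = 0#

  -- The law of a fictitious process in which the core is informed and everyone else silent. It is
  -- the actual law while exactly the core is covered.
  coreProb : ∀ {m} → History n m → Fin n → ℝ
  coreProb h i = coreProbOf (side i) (π i (schedule h i))

  coreProb-nonneg : ∀ {m} (h : History n m) i → 0# ≤ coreProb h i
  coreProb-nonneg h i = lem (side i)
    where
    lem : ∀ s → 0# ≤ coreProbOf s (π i (schedule h i))
    lem core   = proj₁ (π-prob i (schedule h i))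
    lem middle = ≤-refl
    lem rest   = ≤-refl

  coreProb-≤1 : ∀ {m} (h : History n m) i → coreProb h i ≤ 1#
  coreProb-≤1 h i = lem (side i)
    where
    lem : ∀ s → coreProbOf s (π i (schedule h i)) ≤ 1#
    lem core   = proj₂ (π-prob i (schedule h i))
    lem middle = 0≤1
    lem rest   = 0≤1

  Heavy : ∀ {m} → History n m → Set
  Heavy h = θ ≤ sum {n} (coreProb h)

  heavy? : ∀ {m} (h : History n m) → Dec (Heavy h)
  heavy? h = em

  -- The decision is an argument, here and in `windowMode` and `startWith`, because `em` does not
  -- compute: lemmas are proved by cases on an arbitrary decision.
  lightCost : ∀ {A : Set} → Dec A → ℝ → ℝ
  lightCost (yes _) _ = 0#
  lightCost (no _)  p = p

  -- The expected number of light slots, among the next c ones, in which u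
  -- transmits.  It depends on the core nodes only, hence not on the
  -- adversary's choice of u.
  cost : Fin n → ℕ → ∀ {m} → History n m → ℝ
  cost u zero    h = 0#
  cost u (suc c) h = lightCost (heavy? h) (coreProb h u) +
                     Σ-subsets n (λ τ → bernoulli (coreProb h) τ * cost u c (τ ∷ h))

  cost-nonneg : ∀ u c {m} (h : History n m) → 0# ≤ cost u c h
  cost-nonneg u zero    h = ≤-refl
  cost-nonneg u (suc c) h = +-nonneg (lem (heavy? h)) (≤-respˡ
    (trans (Σ-subsets-*ˡ n 0# (λ _ → 0#)) (zeroˡ _))
    (Σ-subsets-mono n λ τ → ≤-respˡ (sym (zeroˡ _)) (*-nonneg (bernoulli-nonneg (coreProb-nonneg h) (coreProb-≤1 h) τ) (cost-nonneg u c (τ ∷ h)))))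
    where
    lem : ∀ {A} (d : Dec A) → 0# ≤ lightCost d (coreProb h u)
    lem (yes _) = ≤-refl
    lem (no _)  = coreProb-nonneg h u

  -- A light slot contributes the sum of the core probabilities, which is below `θ` by definition; a
  -- heavy one contributes nothing.
  total-cost-≤ : ∀ c {m} (h : History n m) → sum {n} (λ u → cost u c h) ≤ fromℕ c * θ
  total-cost-≤ zero h = ≤-reflexive (trans (sum-≈0 n) (sym (zeroˡ θ)))
    where
    sum-≈0 : ∀ m → sum {m} (λ _ → 0#) ≈ 0#
    sum-≈0 zero    = refl
    sum-≈0 (suc m) = trans (+-identityˡ _) (sum-≈0 m)
  total-cost-≤ (suc c) h = begin
    sum {n} (λ u → lightCost (heavy? h) (p u) + Σ-subsets n (λ τ → bernoulli p τ * cost u c (τ ∷ h)))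
      ≈⟨ ∑-distrib-+ {n} _ _ ⟩
    sum {n} (λ u → lightCost (heavy? h) (p u)) + sum {n} (λ u → Σ-subsets n (λ τ → bernoulli p τ * cost u c (τ ∷ h)))
      ≤⟨ +-mono-≤ (light (heavy? h)) (≤-reflexive (sum-Σ-subsets n (λ u τ → bernoulli p τ * cost u c (τ ∷ h)))) ⟩
    θ + Σ-subsets n (λ τ → sum {n} (λ u → bernoulli p τ * cost u c (τ ∷ h)))
      ≈⟨ +-congˡ (Σ-subsets-cong n λ τ → *-distribˡ-sum {n} (bernoulli p τ) (λ u → cost u c (τ ∷ h))) ⟨
    θ + Σ-subsets n (λ τ → bernoulli p τ * sum {n} (λ u → cost u c (τ ∷ h)))
      ≤⟨ +-monoʳ-≤ θ (expectation-mono (coreProb-nonneg h) (coreProb-≤1 h) λ τ _ → total-cost-≤ c (τ ∷ h)) ⟩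
    θ + Σ-subsets n (λ τ → bernoulli p τ * (fromℕ c * θ))
      ≈⟨ +-congˡ (expectation-const p (fromℕ c * θ)) ⟩
    θ + fromℕ c * θ
      ≈⟨ solve 2 (λ c θ → θ :+ c :* θ := (:1 :+ c) :* θ) refl (fromℕ c) θ ⟩
    fromℕ (suc c) * θ ∎
    where
    open ≤-Reasoning
    p = coreProb h
    light : (d : Dec (Heavy h)) → sum {n} (λ u → lightCost d (p u)) ≤ θ
    light (yes _)   = ≤-respˡ (sym (trans (sum-cong-≋ {n = n} (λ u → sym (zeroˡ 0#)))
                        (trans (sym (*-distribˡ-sum {n} 0# (λ _ → 0#))) (zeroˡ _)))) 0≤θ
    light (no ¬hvy) = <⇒≤ (≰⇒> ¬hvy)

  cheap-node : ∀ {m} (h : History n m) →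
               ∃ λ u → (toℕ u ℕ.< k) × (fromℕ k * cost u β h ≤ fromℕ β * θ)
  cheap-node h = proj₁ least , proj₁ (proj₂ least) ,
    ≤-trans (many-small-sum (λ u → cost u β h) (λ u → cost-nonneg u β h) (ℕₚ.<⇒≤ k<n) (proj₂ (proj₂ least)))
            (total-cost-≤ β h)
    where least = minimum-below (λ u → cost u β h) 0<k (ℕₚ.<⇒≤ k<n)

  -- `spread` lasts until the core is covered. In `window u c` there are `c` slots left;
  -- `window u zero` is permanent, with all nodes at home.
  data Phase : Set where
    spread : Phase
    window : Fin n → ℕ → Phase

  windowMode : ∀ {A : Set} → Fin n → Dec A → Mode
  windowMode u (yes _) = record { touch = λ _ → true ; free = false }
  windowMode u (no _)  = record { touch = λ i → does (i ≟ᶠ u) ; free = false }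

  modeOf : ∀ {m} → History n m → Phase → Mode
  modeOf h spread             = record { touch = λ _ → false ; free = false }
  modeOf h (window u zero)    = record { touch = λ _ → true ; free = true }
  modeOf h (window u (suc c)) = windowMode u (heavy? h)

  startWith : ∀ {A : Set} → Fin n → Dec A → Phase
  startWith u (yes _) = window u β
  startWith u (no _)  = spread

  mutual
    -- The strategy reacts to coverage, which in turn depends on the strategy. Both are therefore
    -- defined together by recursion on the history, and identified with `coveredᵇ` of the resulting
    -- MANET afterwards.
    cov : ∀ {m} → History n m → Fin n → Bool
    cov []      i = does (i ≟ᶠ src)
    cov (τ ∷ h) i = cov h i ∨ hears (modeOf h (phase h)) τ i

    Full : ∀ {m} → History n m → Set
    Full h = ∀ i → toℕ i ℕ.< k → cov h i ≡ true

    start : ∀ {m} → History n m → Phase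
    start h = startWith (proj₁ (cheap-node h)) (em {P = Full h})

    next : ∀ {m} → History n m → Phase → Phase
    next h spread             = start h
    next h (window u zero)    = window u zero
    next h (window u (suc c)) = window u c

    phase : ∀ {m} → History n m → Phase
    phase []      = start []
    phase (τ ∷ h) = next (τ ∷ h) (phase h)

  mode : ∀ {m} → History n m → Mode
  mode h = modeOf h (phase h)

  manet : MANET n Vmax
  manet = record
    { source        = src
    ; t₁            = 0
    ; active        = λ _ → ⊤
    ; position      = λ h → place (mode h)
    ; source-active = λ _ → ∈⊤
    ; distinct      = λ h {i} {j} i≢j u _ _ → pos-distinct {cluster i} {excursion (mode h) i} {cluster j} {excursion (mode h) j} i≢j
    ; speed         = λ h i u v → pos-speed (cluster i) i u v (excursion≤2 (side i) (touch (mode h) i) (free (mode h)))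
    ; continuous    = λ h τ i → pos-continuous (cluster i) (excursion (mode h) i) (excursion (mode (τ ∷ h)) i) i
    }

  private
    cong₃ : ∀ {A B C D : Set} (f : A → B → C → D) {a a′ b b′ c c′} →
            a ≡ a′ → b ≡ b′ → c ≡ c′ → f a b c ≡ f a′ b′ c′
    cong₃ f ≡.refl ≡.refl ≡.refl = ≡.refl

  -- Which links are present or cut in which mode.

  place-≡ : ∀ μ {i s a b} → side i ≡ s → touch μ i ≡ a → free μ ≡ b →
            place μ i ≡ pos (clusterOf s) (excursionOf s a b) i
  place-≡ μ {i} = cong₃ (λ s a b → pos (clusterOf s) (excursionOf s a b) i)

  rest-far : ∀ {μ i j} → free μ ≡ false → k ℕ.< toℕ i → toℕ j ℕ.≤ k → ¬ Linked μ i j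
  rest-far {μ} {i} {j} free≡ k<i j≤k (_ , near) = far (touch μ j) (ℕₚ.m≤n⇒m<n∨m≡n j≤k) ≡.refl
    where
    at-i : place μ i ≡ pos 2 2 i
    at-i = place-≡ μ (side-rest k<i) ≡.refl free≡
    far : ∀ b → toℕ j ℕ.< k ⊎ toℕ j ≡ k → ¬ (touch μ j ≡ b)
    far true  (inj₁ j<k) b≡ = outOfRange-> {1} {2} {0} {2} i j (ℕ.s≤s (ℕ.s≤s ℕ.z≤n)) (ℕ.s≤s ℕ.z≤n)
      (≡.subst₂ InRange at-i (place-≡ μ (side-core j<k) b≡ ≡.refl) near)
    far false (inj₁ j<k) b≡ = outOfRange-> {1} {2} {1} {2} i j (ℕ.s≤s (ℕ.s≤s ℕ.z≤n)) (ℕ.s≤s (ℕ.s≤s ℕ.z≤n))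
      (≡.subst₂ InRange at-i (place-≡ μ (side-core j<k) b≡ ≡.refl) near)
    far b     (inj₂ j≡k) b≡ = outOfRange-> {0} {2} {0} {2} i j (ℕ.s≤s ℕ.z≤n) (ℕ.s≤s ℕ.z≤n)
      (≡.subst₂ InRange at-i (place-≡ μ (side-middle j≡k) b≡ ≡.refl) near)

  target-far : ∀ {μ i j} → touch μ j ≡ false → toℕ i ≡ k → toℕ j ℕ.< k → ¬ Linked μ i j
  target-far {μ} {i} {j} away i≡k j<k (_ , near) = outOfRange-< {0} {1} {0} {1} i j (ℕ.s≤s ℕ.z≤n) (ℕ.s≤s ℕ.z≤n)
    (≡.subst₂ InRange (place-≡ μ (side-middle i≡k) ≡.refl ≡.refl) (place-≡ μ (side-core j<k) away ≡.refl) near)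

  -- Equal `touch` excludes the pairs of a light slot with only one node at home. While the
  -- information spreads, the whole core moves together.
  core-core : ∀ {μ i j} → touch μ i ≡ touch μ j → toℕ i ℕ.< k → toℕ j ℕ.< k → i ≢ j → Linked μ i j
  core-core {μ} {i} {j} same i<k j<k i≢j = i≢j , ≡.subst₂ InRange
    (≡.sym (place-≡ μ (side-core i<k) same ≡.refl)) (≡.sym (place-≡ μ (side-core j<k) ≡.refl ≡.refl))
    (inRange-same 1 (excursionOf core (touch μ j) (free μ)) i j)

  target-core : ∀ {μ i j} → touch μ j ≡ true → toℕ i ≡ k → toℕ j ℕ.< k → Linked μ i j
  target-core {μ} {i} {j} home i≡k j<k =
    (λ i≡j → ℕₚ.<-irrefl (≡.trans (≡.cong toℕ (≡.sym i≡j)) i≡k) j<k) , ≡.subst₂ InRange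
    (≡.sym (place-≡ μ (side-middle i≡k) ≡.refl ≡.refl)) (≡.sym (place-≡ μ (side-core j<k) home ≡.refl))
    (inRange-next 0 0 i j)

  core-target : ∀ {μ i j} → touch μ i ≡ true → toℕ i ℕ.< k → toℕ j ≡ k → Linked μ i j
  core-target {μ} {i} {j} home i<k j≡k =
    (λ i≡j → ℕₚ.<-irrefl (≡.trans (≡.cong toℕ i≡j) j≡k) i<k) , ≡.subst₂ InRange
    (≡.sym (place-≡ μ (side-core i<k) home ≡.refl)) (≡.sym (place-≡ μ (side-middle j≡k) ≡.refl ≡.refl))
    (inRange-prev 0 0 i j)

  core-rest : ∀ {μ i j} → touch μ i ≡ true → free μ ≡ true → toℕ i ℕ.< k → k ℕ.< toℕ j → Linked μ i j
  core-rest {μ} {i} {j} home free≡ i<k k<j =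
    (λ i≡j → ℕₚ.<-irrefl (≡.cong toℕ i≡j) (ℕₚ.<-trans i<k k<j)) , ≡.subst₂ InRange
    (≡.sym (place-≡ μ (side-core i<k) home ≡.refl)) (≡.sym (place-≡ μ (side-rest k<j) ≡.refl free≡))
    (inRange-next 1 0 i j)

  free-windowMode : ∀ {A : Set} u (d : Dec A) → free (windowMode u d) ≡ false
  free-windowMode u (yes _) = ≡.refl
  free-windowMode u (no _)  = ≡.refl

  touch-windowMode : ∀ {A : Set} u (d : Dec A) → touch (windowMode u d) u ≡ true
  touch-windowMode u (yes _) = ≡.refl
  touch-windowMode u (no _)  = dec-true (u ≟ᶠ u) ≡.refl

  cov-src : ∀ {m} (h : History n m) → cov h src ≡ true
  cov-src []      = dec-true (src ≟ᶠ src) ≡.refl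
  cov-src (τ ∷ h) = ≡.cong (_∨ hears (mode h) τ src) (cov-src h)

  cov-mono : ∀ {m} (h : History n m) τ i → cov h i ≡ true → cov (τ ∷ h) i ≡ true
  cov-mono h τ i c = ≡.cong (_∨ hears (mode h) τ i) c

  private
    does-true : ∀ {A : Set} (d : Dec A) → does d ≡ true → A
    does-true (yes a) _ = a

    ∨-true : ∀ a {b} → a ∨ b ≡ true → a ≡ true ⊎ b ≡ true
    ∨-true true  _ = inj₁ ≡.refl
    ∨-true false p = inj₂ p

    true⊎false : ∀ b → b ≡ true ⊎ b ≡ false
    true⊎false true  = inj₁ ≡.refl
    true⊎false false = inj₂ ≡.refl

    true≢false : ∀ {b} → b ≡ true → b ≢ false
    true≢false ≡.refl ()

  newly-covered-hears : ∀ {m} (h : History n m) τ i → cov (τ ∷ h) i ≡ true →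
                        cov h i ≡ true ⊎ Hears (mode h) τ i
  newly-covered-hears h τ i c = lem (∨-true (cov h i) c)
    where
    lem : cov h i ≡ true ⊎ hears (mode h) τ i ≡ true → cov h i ≡ true ⊎ Hears (mode h) τ i
    lem (inj₁ c)  = inj₁ c
    lem (inj₂ hr) = inj₂ (does-true em hr)

  -- Invariants of the phases.

  CoreOnly : ∀ {m} → History n m → Set
  CoreOnly h = ∀ i → cov h i ≡ true → toℕ i ℕ.< k

  NoRest : ∀ {m} → History n m → Set
  NoRest h = ∀ i → cov h i ≡ true → toℕ i ℕ.≤ k

  Sound : ∀ {m} → History n m → Subset n → Set
  Sound h τ = ∀ i → i ∈ τ → cov h i ≡ true

  -- The claim about outer nodes is dropped at `c = 0`, since the phase then persists and those
  -- nodes come into range of the core.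
  Inv : ∀ {m} → Phase → History n m → Set
  Inv spread       h = ¬ Full h × CoreOnly h
  Inv (window u c) h = Full h × (toℕ u ℕ.< k) × (c ≢ 0 → NoRest h)

  start-inv : ∀ {m} (h : History n m) → CoreOnly h → Inv (start h) h
  start-inv h coreOnly = lem em
    where
    lem : (d : Dec (Full h)) → Inv (startWith (proj₁ (cheap-node h)) d) h
    lem (yes full) = full , proj₁ (proj₂ (cheap-node h)) , λ _ i c → ℕₚ.<⇒≤ (coreOnly i c)
    lem (no ¬full) = ¬full , coreOnly

  -- All transmitters lie in the core, and while the phase is `spread` the excursions cut every link
  -- from the core to the outside.
  coreOnly-step : ∀ {m} (h : History n m) τ → phase h ≡ spread → CoreOnly h → Sound h τ → CoreOnly (τ ∷ h)
  coreOnly-step h τ φ≡ coreOnly sound i c = lem (newly-covered-hears h τ i c)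
    where
    lem : cov h i ≡ true ⊎ Hears (mode h) τ i → toℕ i ℕ.< k
    lem (inj₁ c) = coreOnly i c
    lem (inj₂ (_ , _ , j , linked , j∈τ , _)) = place-i (ℕₚ.<-cmp (toℕ i) k)
      where
      j<k : toℕ j ℕ.< k
      j<k = coreOnly j (sound j j∈τ)
      place-i : Tri (toℕ i ℕ.< k) (toℕ i ≡ k) (k ℕ.< toℕ i) → toℕ i ℕ.< k
      place-i (tri< i<k _ _) = i<k
      place-i (tri≈ _ i≡k _) = ⊥-elim (target-far (≡.cong (λ φ → touch (modeOf h φ) j) φ≡) i≡k j<k linked)
      place-i (tri> _ _ k<i) = ⊥-elim (rest-far (≡.cong (λ φ → free (modeOf h φ)) φ≡) k<i (ℕₚ.<⇒≤ j<k) linked)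

  noRest-step : ∀ {m} (h : History n m) τ {u c} → phase h ≡ window u (suc c) → NoRest h → Sound h τ → NoRest (τ ∷ h)
  noRest-step h τ {u} {c} φ≡ noRest sound i cov-i = lem (newly-covered-hears h τ i cov-i)
    where
    free≡ : free (mode h) ≡ false
    free≡ = ≡.trans (≡.cong (λ φ → free (modeOf h φ)) φ≡) (free-windowMode u (heavy? h))
    lem : cov h i ≡ true ⊎ Hears (mode h) τ i → toℕ i ℕ.≤ k
    lem (inj₁ c) = noRest i c
    lem (inj₂ (_ , _ , j , linked , j∈τ , _)) =
      ℕₚ.≮⇒≥ λ k<i → rest-far free≡ k<i (noRest j (sound j j∈τ)) linked

  inv-step : ∀ {m} (h : History n m) τ φ → phase h ≡ φ → Inv φ h → Sound h τ → Inv (next (τ ∷ h) φ) (τ ∷ h)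
  inv-step h τ spread φ≡ (_ , coreOnly) sound = start-inv (τ ∷ h) (coreOnly-step h τ φ≡ coreOnly sound)
  inv-step h τ (window u zero) φ≡ (full , u<k , _) sound =
    (λ i i<k → cov-mono h τ i (full i i<k)) , u<k , λ 0≢0 → ⊥-elim (0≢0 ≡.refl)
  inv-step h τ (window u (suc c)) φ≡ (full , u<k , noRest) sound =
    (λ i i<k → cov-mono h τ i (full i i<k)) , u<k , λ _ → noRest-step h τ φ≡ (noRest λ ()) sound

  coreOnly-[] : CoreOnly []
  coreOnly-[] i c = ≡.subst (λ j → toℕ j ℕ.< k) (≡.sym (does-true (i ≟ᶠ src) c)) src<k

  ¬Full⇒uncovered : ∀ {m} {h : History n m} → ¬ Full h → ∃ λ i → (toℕ i ℕ.< k) × (cov h i ≡ false)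
  ¬Full⇒uncovered {h = h} ¬full = decide em
    where
    decide : Dec (∃ λ i → (toℕ i ℕ.< k) × (cov h i ≡ false)) → ∃ λ i → (toℕ i ℕ.< k) × (cov h i ≡ false)
    decide (yes found) = found
    decide (no none)   = ⊥-elim (¬full λ i i<k → lem i i<k (true⊎false (cov h i)))
      where
      lem : ∀ i → toℕ i ℕ.< k → cov h i ≡ true ⊎ cov h i ≡ false → cov h i ≡ true
      lem i i<k (inj₁ c) = c
      lem i i<k (inj₂ c) = ⊥-elim (none (i , i<k , c))

  start-window : ∀ {m} (h : History n m) {u c} → start h ≡ window u c → c ≡ β
  start-window h = lem em
    where
    lem : ∀ {A : Set} (d : Dec A) {u₀ u c} → startWith u₀ d ≡ window u c → c ≡ β
    lem (yes _) ≡.refl = ≡.refl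

  -- The execution of the protocol against this adversary.

  module Run (d : ℝ) (r<d : r < d) where

    open Execution P r d manet

    coveredᵇ≡cov : ∀ {m} (h : History n m) i → coveredᵇ h i ≡ cov h i
    coveredᵇ≡cov []      i = ∨-identityʳ _
    coveredᵇ≡cov (τ ∷ h) i = ≡.cong (_∨ hears (mode h) τ i) (coveredᵇ≡cov h i)

    -- All nodes run from slot 0 without failing, so local steps are slots, and being informed
    -- coincides with being covered.
    node≡running : ∀ {m} (h : History n m) i → node h i ≡ running (schedule h i) (cov h i)
    node≡running [] i = ≡.trans
      (≡.cong (λ a → if does (i ≟ᶠ src) then inform (switch a inactive) else switch a inactive) (lookup-replicate i true))
      (lem (does (i ≟ᶠ src)))
      where
      lem : ∀ b → (if b then inform (running [] false) else running [] false) ≡ running [] b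
      lem true  = ≡.refl
      lem false = ≡.refl
    node≡running (τ ∷ h) i = ≡.cong₂ (λ a ν → switch a (step (lookup τ i) (hears (mode h) τ i) ν))
      (lookup-replicate i true) (node≡running h i)

    covered⇒cov : ∀ {m} (h : History n m) {i} → i ∈ covered h → cov h i ≡ true
    covered⇒cov h {i} i∈ = ≡.trans (≡.sym (coveredᵇ≡cov h i))
      (≡.trans (≡.sym (lookup∘tabulate (coveredᵇ h) i)) ([]=⇒lookup i∈))

    cov⇒covered : ∀ {m} (h : History n m) {i} → cov h i ≡ true → i ∈ covered h
    cov⇒covered h {i} c = lookup⇒[]= i _ (≡.trans (lookup∘tabulate (coveredᵇ h) i) (≡.trans (coveredᵇ≡cov h i) c))

    cov⇒informed : ∀ {m} (h : History n m) {i} → cov h i ≡ true → i ∈ informed h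
    cov⇒informed h {i} c = lookup⇒[]= i _ (≡.trans (lookup∘tabulate (λ i → informedᵇ (node h i)) i)
      (≡.trans (≡.cong informedᵇ (node≡running h i)) c))

    uncov⇒∉covered : ∀ {m} (h : History n m) {i} → cov h i ≡ false → i ∉ covered h
    uncov⇒∉covered h c i∈ = true≢false (covered⇒cov h i∈) c

    uninformed-silent : ∀ {m} (h : History n m) i → cov h i ≡ false → transmitProb i (node h i) ≈ 0#
    uninformed-silent h i c = reflexive (≡.trans (≡.cong (transmitProb i) (node≡running h i))
      (≡.cong (λ b → transmitProb i (running (schedule h i) b)) c))

    slotProb≉0⇒sound : ∀ {m} (h : History n m) τ → ¬ (slotProb h τ ≈ 0#) → Sound h τ
    slotProb≉0⇒sound h τ p≉0 i i∈τ = lem (true⊎false (cov h i))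
      where
      lem : cov h i ≡ true ⊎ cov h i ≡ false → cov h i ≡ true
      lem (inj₁ c) = c
      lem (inj₂ c) = ⊥-elim (p≉0 (bernoulli-0 {p = λ i → transmitProb i (node h i)} τ i
        (uninformed-silent h i c) ([]=⇒lookup i∈τ)))

    inv : ∀ {m} (h : History n m) → Possible h → Inv (phase h) h
    inv []      _           = start-inv [] coreOnly-[]
    inv (τ ∷ h) (0<p , poss) = inv-step h τ (phase h) ≡.refl (inv h poss) (slotProb≉0⇒sound h τ (pos⇒≉0 0<p))

    simultaneous : SimultaneousNoFailures
    simultaneous = 0 , λ h i → mk⇔ (λ _ → ℕ.z≤n) (λ _ → ∈⊤)

    allTargets : AllTargets
    allTargets ω i = ∈⊤ , ≤-trans
      (≡.subst (λ c → dist (place (mode []) i 0#) (pos c (excursion (mode []) src) src 0#) ≤ r)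
        (≡.sym (≡.cong clusterOf (side-core src<k)))
        (initial-dist-≤ (excursion (mode []) i) (excursion (mode []) src) i src (clusterOf≤2 (side i))))
      (<⇒≤ r<d)
      where
      clusterOf≤2 : ∀ s → clusterOf s ℕ.≤ 2
      clusterOf≤2 middle = ℕ.z≤n
      clusterOf≤2 core   = ℕ.s≤s ℕ.z≤n
      clusterOf≤2 rest   = ℕ.s≤s (ℕ.s≤s ℕ.z≤n)

    -- Connectivity.

    module _ (ω : ℕ → Subset n) (poss : ∀ m → Possible (prefix ω m)) where

      done-forever : ∀ {u t} o → phase (prefix ω t) ≡ window u 0 → phase (prefix ω (o ℕ.+ t)) ≡ window u 0
      done-forever zero    φ≡ = φ≡
      done-forever {t = t} (suc o) φ≡ = ≡.cong (next (prefix ω (suc (o ℕ.+ t)))) (done-forever o φ≡)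

      countdown : ∀ {u c t} o → phase (prefix ω t) ≡ window u (o ℕ.+ c) → phase (prefix ω (o ℕ.+ t)) ≡ window u c
      countdown zero φ≡ = φ≡
      countdown {u} {c} {t} (suc o) φ≡ = ≡.cong (next (prefix ω (suc (o ℕ.+ t))))
        (countdown {c = suc c} o (≡.trans φ≡ (≡.cong (window u) (≡.sym (ℕₚ.+-suc o c)))))

      -- The opening slot of the current window, recovered from the number of slots left. `CoreOnly`
      -- there shows that the target was still uncovered.
      Origin : Fin n → ℕ → ℕ → Set
      Origin u c t = ∃ λ t′ → (t′ ℕ.≤ t) × (t′ ℕ.+ β ≡ t ℕ.+ c) ×
                     (phase (prefix ω t′) ≡ window u β) × CoreOnly (prefix ω t′)

      origin : ∀ {u c} t → phase (prefix ω t) ≡ window u (suc c) → Origin u (suc c) t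
      origin {u} zero φ≡ = 0 , ℕ.z≤n , ≡.sym c≡β , ≡.trans φ≡ (≡.cong (window u) c≡β) , coreOnly-[]
        where c≡β = start-window [] φ≡
      origin {u} {c} (suc t) φ′≡ = lem (phase (prefix ω t)) ≡.refl φ′≡ (inv (prefix ω t) (proj₂ (poss (suc t))))
        where
        lem : ∀ φ → phase (prefix ω t) ≡ φ → next (prefix ω (suc t)) φ ≡ window u (suc c) →
              Inv φ (prefix ω t) → Origin u (suc c) (suc t)
        lem spread φ≡ started (_ , coreOnly) =
          suc t , ℕₚ.≤-refl , ≡.cong (suc t ℕ.+_) (≡.sym c≡β) ,
          ≡.trans φ′≡ (≡.cong (window u) c≡β) ,
          coreOnly-step (prefix ω t) (ω t) φ≡ coreOnly (slotProb≉0⇒sound (prefix ω t) (ω t) (pos⇒≉0 (proj₁ (poss (suc t)))))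
          where c≡β = start-window (prefix ω (suc t)) started
        lem (window _ (suc _)) φ≡ ≡.refl _ = earlier (origin t φ≡)
          where
          earlier : Origin u (suc (suc c)) t → Origin u (suc c) (suc t)
          earlier (t′ , t′≤t , eq , begun) =
            t′ , ℕₚ.m≤n⇒m≤1+n t′≤t , ≡.trans eq (ℕₚ.+-suc t (suc c)) , begun

      -- A link witnessing connectivity must persist in later slots. As long as one core node is
      -- uncovered no window can have opened, so the core is still together.
      uncovered⇒spread : ∀ t {i} → toℕ i ℕ.< k → cov (prefix ω t) i ≢ true → phase (prefix ω t) ≡ spread
      uncovered⇒spread t {i} i<k ¬c = lem (phase (prefix ω t)) ≡.refl (inv (prefix ω t) (poss t))
        where
        lem : ∀ φ → phase (prefix ω t) ≡ φ → Inv φ (prefix ω t) → phase (prefix ω t) ≡ spread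
        lem spread       φ≡ _          = φ≡
        lem (window _ _) φ≡ (full , _) = ⊥-elim (¬c (full i i<k))

    -- Before and after the window, the witness starts at `t` itself. Within it, the witness starts
    -- at the opening of the window, because at `t` the target may already be covered while the
    -- outer nodes are still out of reach.
    connected : 0 ℕ.< β → ∀ α → Connected α β
    connected 0<β α run@(ω , poss) t _ unsolved = lem (phase h) ≡.refl (inv h (poss t))
      where
      h = prefix ω t
      Link : Set
      Link = ∃ λ t′ →
        (∃ λ t″ → (t ℕ.≤ t″ × t″ ℕ.≤ t ℕ.+ α) × (t′ ℕ.≤ t″ × t″ ℕ.< t′ ℕ.+ β)) ×
        (∃ λ p → ∃ λ p′ →
           p ∈ informed (at run t′) × p′ ∉ covered (at run t′) ×
           (∀ u → t′ ℕ.≤ u → u ℕ.< t′ ℕ.+ β → p′ ∉ covered (at run u) →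
              p ∈ ⊤ × p′ ∈ ⊤ × Linked (mode (at run u)) p p′))
      now : ∃ λ t″ → (t ℕ.≤ t″ × t″ ℕ.≤ t ℕ.+ α) × (t ℕ.≤ t″ × t″ ℕ.< t ℕ.+ β)
      now = t , (ℕₚ.≤-refl , ℕₚ.m≤m+n t α) , (ℕₚ.≤-refl , ℕₚ.m<m+n t 0<β)
      some-uncovered : ∃ λ i → cov h i ≡ false
      some-uncovered = decide em
        where
        decide : Dec (∃ λ i → cov h i ≡ false) → ∃ λ i → cov h i ≡ false
        decide (yes found) = found
        decide (no none) = ⊥-elim (unsolved λ i _ → cov⇒covered h (cov-true i (true⊎false (cov h i))))
          where
          cov-true : ∀ i → cov h i ≡ true ⊎ cov h i ≡ false → cov h i ≡ true
          cov-true i (inj₁ c) = c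
          cov-true i (inj₂ c) = ⊥-elim (none (i , c))
      lem : ∀ φ → phase h ≡ φ → Inv φ h → Link
      lem spread φ≡ (¬full , _) = linked (¬Full⇒uncovered {h = h} ¬full)
        where
        linked : (∃ λ i → (toℕ i ℕ.< k) × (cov h i ≡ false)) → Link
        linked (i , i<k , c) = t , now , src , i , cov⇒informed h (cov-src h) , uncov⇒∉covered h c ,
          λ u _ _ i∉ → let ¬c = i∉ ∘ cov⇒covered (prefix ω u)
                           φ≡′ = uncovered⇒spread ω poss u i<k ¬c
                       in ∈⊤ , ∈⊤ ,
            core-core {mode (prefix ω u)}
              (≡.trans (≡.cong (λ φ → touch (modeOf (prefix ω u) φ) src) φ≡′)
                       (≡.sym (≡.cong (λ φ → touch (modeOf (prefix ω u) φ) i) φ≡′)))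
              src<k i<k (λ { ≡.refl → ¬c (cov-src (prefix ω u)) })
      lem (window v zero) φ≡ (full , _ , _) = linked some-uncovered
        where
        linked : (∃ λ i → cov h i ≡ false) → Link
        linked (i , c) = t , now , src , i , cov⇒informed h (cov-src h) , uncov⇒∉covered h c , link
          where
          k≤i : k ℕ.≤ toℕ i
          k≤i = ℕₚ.≮⇒≥ λ i<k → true≢false (full i i<k) c
          link : ∀ u → t ℕ.≤ u → u ℕ.< t ℕ.+ β → i ∉ covered (at run u) →
                 src ∈ ⊤ × i ∈ ⊤ × Linked (mode (at run u)) src i
          link u t≤u _ _ = ∈⊤ , ∈⊤ , beyond (ℕₚ.m≤n⇒m<n∨m≡n k≤i)
            where
            φ≡′ : phase (prefix ω u) ≡ window v 0
            φ≡′ = ≡.subst (λ u → phase (prefix ω u) ≡ window v 0) (ℕₚ.m∸n+n≡m t≤u) (done-forever ω poss (u ℕ.∸ t) φ≡)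
            μ = mode (prefix ω u)
            home : touch μ src ≡ true
            home = ≡.cong (λ φ → touch (modeOf (prefix ω u) φ) src) φ≡′
            beyond : k ℕ.< toℕ i ⊎ k ≡ toℕ i → Linked μ src i
            beyond (inj₁ k<i) = core-rest {μ} home (≡.cong (λ φ → free (modeOf (prefix ω u) φ)) φ≡′) src<k k<i
            beyond (inj₂ k≡i) = core-target {μ} home src<k (≡.sym k≡i)
      lem (window v (suc c)) φ≡ (_ , v<k , _) = linked (origin ω poss t φ≡)
        where
        linked : Origin ω poss v (suc c) t → Link
        linked (t′ , t′≤t , eq , φ′≡ , coreOnly) =
          t′ , (t , (ℕₚ.≤-refl , ℕₚ.m≤m+n t α) , (t′≤t , ≡.subst (t ℕ.<_) (≡.sym eq) (ℕₚ.m<m+n t (ℕ.s≤s ℕ.z≤n)))) ,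
          v , target , cov⇒informed (prefix ω t′) cov-v ,
          (λ target∈ → ℕₚ.<-irrefl toℕ-target (coreOnly target (covered⇒cov (prefix ω t′) target∈))) ,
          link
          where
          cov-v : cov (prefix ω t′) v ≡ true
          cov-v = proj₁ (≡.subst (λ φ → Inv φ (prefix ω t′)) φ′≡ (inv (prefix ω t′) (poss t′))) v v<k
          link : ∀ u → t′ ℕ.≤ u → u ℕ.< t′ ℕ.+ β → target ∉ covered (at run u) →
                 v ∈ ⊤ × target ∈ ⊤ × Linked (mode (at run u)) v target
          link u t′≤u u<t′+β _ = ∈⊤ , ∈⊤ , core-target {mode (prefix ω u)} home v<k toℕ-target
            where
            o : ℕ
            o = u ℕ.∸ t′
            o+t′≡u : o ℕ.+ t′ ≡ u
            o+t′≡u = ℕₚ.m∸n+n≡m t′≤u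
            o<β : o ℕ.< β
            o<β = ℕₚ.+-cancelˡ-< t′ o β (≡.subst (ℕ._< t′ ℕ.+ β) (≡.trans (≡.sym o+t′≡u) (ℕₚ.+-comm o t′)) u<t′+β)
            left : ∃ λ c → suc o ℕ.+ c ≡ β
            left = ℕₚ.m≤n⇒∃[o]m+o≡n o<β
            φ≡u : phase (prefix ω u) ≡ window v (suc (proj₁ left))
            φ≡u = ≡.subst (λ u → phase (prefix ω u) ≡ window v (suc (proj₁ left))) o+t′≡u
              (countdown ω poss o (≡.trans φ′≡ (≡.cong (window v) (≡.sym (≡.trans (ℕₚ.+-suc o (proj₁ left)) (proj₂ left))))))
            home : touch (mode (prefix ω u)) v ≡ true
            home = ≡.trans (≡.cong (λ φ → touch (modeOf (prefix ω u) φ) v) φ≡u) (touch-windowMode v (heavy? (prefix ω u)))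

    -- The expected number of nodes covered during a window.

    transmitProb-bounds : ∀ i ν → (0# ≤ transmitProb i ν) × (transmitProb i ν ≤ 1#)
    transmitProb-bounds i inactive          = ≤-refl , 0≤1
    transmitProb-bounds i (running s false) = ≤-refl , 0≤1
    transmitProb-bounds i (running s true)  = π-prob i s

    Uncovered : ∀ {m} → History n m → Set
    Uncovered h = cov h target ≡ false

    noRest⇒coreOnly : ∀ {m} (h : History n m) → NoRest h → Uncovered h → CoreOnly h
    noRest⇒coreOnly h noRest unc i c = lem (ℕₚ.m≤n⇒m<n∨m≡n (noRest i c))
      where
      lem : toℕ i ℕ.< k ⊎ toℕ i ≡ k → toℕ i ℕ.< k
      lem (inj₁ i<k) = i<k
      lem (inj₂ i≡k) = ⊥-elim (true≢false (≡.subst (λ j → cov h j ≡ true)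
        (toℕ-injective (≡.trans i≡k (≡.sym toℕ-target))) c) unc)

    -- Joins the actual execution to the fictitious core process behind `cost`.
    transmitProb≈coreProb : ∀ {m} (h : History n m) → Full h → CoreOnly h →
                            ∀ i → transmitProb i (node h i) ≈ coreProb h i
    transmitProb≈coreProb h full coreOnly i = trans (reflexive (≡.cong (transmitProb i) (node≡running h i)))
      (lem (ℕₚ.<-cmp (toℕ i) k))
      where
      s = schedule h i
      silent : k ℕ.≤ toℕ i → ∀ b → cov h i ≡ b → transmitProb i (running s b) ≈ 0#
      silent k≤i true  c = ⊥-elim (ℕₚ.<⇒≱ (coreOnly i c) k≤i)
      silent k≤i false c = refl
      lem : Tri (toℕ i ℕ.< k) (toℕ i ≡ k) (k ℕ.< toℕ i) → transmitProb i (running s (cov h i)) ≈ coreProb h i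
      lem (tri< i<k _ _) = reflexive (≡.trans (≡.cong (λ b → transmitProb i (running s b)) (full i i<k))
        (≡.sym (≡.cong (λ x → coreProbOf x (π i s)) (side-core i<k))))
      lem (tri≈ _ i≡k _) = trans (silent (ℕₚ.≤-reflexive (≡.sym i≡k)) (cov h i) ≡.refl)
        (reflexive (≡.sym (≡.cong (λ x → coreProbOf x (π i s)) (side-middle i≡k))))
      lem (tri> _ _ k<i) = trans (silent (ℕₚ.<⇒≤ k<i) (cov h i) ≡.refl)
        (reflexive (≡.sym (≡.cong (λ x → coreProbOf x (π i s)) (side-rest k<i))))

    x∈p─q⇒x∉q : ∀ {m} (p q : Subset m) {x} → x ∈ p ─ q → x ∉ q
    x∈p─q⇒x∉q (_ ∷ p) (true  ∷ q) (there x∈p─q) (there x∈q) = x∈p─q⇒x∉q p q x∈p─q x∈q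
    x∈p─q⇒x∉q (_ ∷ p) (false ∷ q) (there x∈p─q) (there x∈q) = x∈p─q⇒x∉q p q x∈p─q x∈q

    newly-⊆ : ∀ {m m′} (h₀ : History n m) (h : History n m′) → Full h₀ → ∀ {i} →
              i ∈ covered h ─ covered h₀ → (cov h i ≡ true) × (k ℕ.≤ toℕ i)
    newly-⊆ h₀ h full {i} i∈ =
      covered⇒cov h (p─q⊆p (covered h) (covered h₀) i∈) ,
      ℕₚ.≮⇒≥ λ i<k → x∈p─q⇒x∉q (covered h) (covered h₀) i∈ (cov⇒covered h₀ (full i i<k))

    newlyCovered-≤1 : ∀ {m m′} (h₀ : History n m) (h : History n m′) → Full h₀ → NoRest h →
                      newlyCovered h₀ h ≤ 1#
    newlyCovered-≤1 h₀ h full noRest = ≤-respʳ (+-identityʳ 1#) (fromℕ-mono-≤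
      (ℕₚ.≤-trans (p⊆q⇒∣p∣≤∣q∣ sub) (ℕₚ.≤-reflexive (∣⁅x⁆∣≡1 target))))
      where
      sub : covered h ─ covered h₀ ⊆ ⁅ target ⁆
      sub {i} i∈ = ≡.subst (_∈ ⁅ target ⁆) (≡.sym (toℕ-injective (≡.trans (ℕₚ.≤-antisym (noRest i (proj₁ facts)) (proj₂ facts)) (≡.sym toℕ-target)))) (x∈⁅x⁆ target)
        where facts = newly-⊆ h₀ h full i∈

    newlyCovered-≤0 : ∀ {m m′} (h₀ : History n m) (h : History n m′) → Full h₀ → CoreOnly h →
                      newlyCovered h₀ h ≤ 0#
    newlyCovered-≤0 h₀ h full coreOnly = fromℕ-mono-≤
      (ℕₚ.≤-trans (p⊆q⇒∣p∣≤∣q∣ sub) (ℕₚ.≤-reflexive (∣⊥∣≡0 n)))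
      where
      sub : covered h ─ covered h₀ ⊆ ⊥
      sub {i} i∈ = ⊥-elim (ℕₚ.<⇒≱ (coreOnly i (proj₁ facts)) (proj₂ facts))
        where facts = newly-⊆ h₀ h full i∈

    -- Unlike in `Inv`, `NoRest` is kept at `c = 0`: the expectation is evaluated exactly when the
    -- count reaches 0, before any slot with the outer nodes in range.
    InWindow : ∀ {m} → Fin n → ℕ → History n m → Set
    InWindow u c h = (phase h ≡ window u c) × Full h × NoRest h

    inWindow-step : ∀ {m} (h : History n m) τ {u c} → InWindow u (suc c) h → Sound h τ → InWindow u c (τ ∷ h)
    inWindow-step h τ (φ≡ , full , noRest) sound =
      ≡.cong (next (τ ∷ h)) φ≡ , (λ i i<k → cov-mono h τ i (full i i<k)) , noRest-step h τ φ≡ noRest sound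

    module _ {m₀} (h₀ : History n m₀) (full₀ : Full h₀) where

      -- With the core already covered and the outer nodes out of range, only the target can be new.
      gain-≤1 : ∀ c {m} (h : History n m) {u} → InWindow u c h → 𝔼 c h (newlyCovered h₀) ≤ 1#
      gain-≤1 zero    h (_ , _ , noRest) = newlyCovered-≤1 h₀ h full₀ noRest
      gain-≤1 (suc c) h inW = ≤-trans
        (expectation-mono (λ i → proj₁ (transmitProb-bounds i (node h i))) (λ i → proj₂ (transmitProb-bounds i (node h i)))
          λ τ p≉0 → gain-≤1 c (τ ∷ h) (inWindow-step h τ inW (slotProb≉0⇒sound h τ p≉0)))
        (≤-reflexive (expectation-const (λ i → transmitProb i (node h i)) 1#))

      module _ {l D : ℝ} (0≤l : 0# ≤ l) (0<D : 0# < D) (exp-l≈D : exp l ≈ D) (2l≤θ : 2# * l ≤ θ) where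

        private
          q : ℝ
          q = 2# * D ⁻¹

          0≤q : 0# ≤ q
          0≤q = *-nonneg (<⇒≤ 0<2) (<⇒≤ (⁻¹-pos 0<D))

        -- Bounds the indicator that the target receives when τ transmits.
        hit : ∀ {A : Set} → Dec A → Fin n → Subset n → ℝ
        hit (yes _) u τ = 2# * ½^∣ τ ∣
        hit (no _)  u τ = indicator (lookup τ u)

        hit-nonneg : ∀ {A : Set} (d : Dec A) u τ → 0# ≤ hit d u τ
        hit-nonneg (yes _) u τ = *-nonneg (<⇒≤ 0<2) (½^∣τ∣-nonneg τ)
        hit-nonneg (no _)  u τ = lem (lookup τ u)
          where
          lem : ∀ b → 0# ≤ indicator b
          lem true  = 0≤1
          lem false = ≤-refl

        -- A heavy slot is paid for by `q`, and a light one by the probability that `u` transmits,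
        -- which is the charge made by `cost`.
        Σ-hit-≤ : ∀ {m} (h : History n m) (d : Dec (Heavy h)) u →
                  Σ-subsets n (λ τ → bernoulli (coreProb h) τ * hit d u τ) ≤ q + lightCost d (coreProb h u)
        Σ-hit-≤ h (yes hvy) u = ≤-respʳ (sym (+-identityʳ q))
          (Σ-2½^∣τ∣-≤ (coreProb-nonneg h) (coreProb-≤1 h) 0≤l (≤-trans 2l≤θ hvy) 0<D exp-l≈D)
        Σ-hit-≤ h (no _)    u = ≤-trans (≤-reflexive (marginal (coreProb h) u)) (x≤y+x 0≤q)

        -- In a heavy slot every transmitter is a core node linked to the target, so reception
        -- leaves only one. In a light slot the node heard must be `u`, the only core node in range.
        hears⇒1≤hit : ∀ {m} (h : History n m) (d : Dec (Heavy h)) {u τ} → mode h ≡ windowMode u d →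
                      CoreOnly h → Sound h τ → Hears (mode h) τ target → 1# ≤ hit d u τ
        hears⇒1≤hit h (yes _) {u} {τ} μ≡ coreOnly sound (_ , _ , j , _ , _ , unique) =
          lone⇒1≤2½^∣τ∣ τ {j} λ i i∈τ → let i∈ = lookup⇒[]= i τ i∈τ in
            unique i (target-core (≡.cong (λ μ → touch μ i) μ≡) toℕ-target (coreOnly i (sound i i∈))) i∈
        hears⇒1≤hit h (no _) {u} {τ} μ≡ coreOnly sound (_ , _ , j , linked , j∈τ , _) = lem (j ≟ᶠ u)
          where
          lem : Dec (j ≡ u) → 1# ≤ indicator (lookup τ u)
          lem (yes ≡.refl) = ≤-reflexive (reflexive (≡.cong indicator (≡.sym ([]=⇒lookup j∈τ))))
          lem (no j≢u) = ⊥-elim (target-far (≡.trans (≡.cong (λ μ → touch μ j) μ≡) (dec-false (j ≟ᶠ u) j≢u))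
            toℕ-target (coreOnly j (sound j j∈τ)) linked)

        -- A union bound over the remaining slots, carried out slot by slot. The comparison with the
        -- core law is made only while the target is uncovered, where the two laws agree.
        gain-≤ : ∀ c {m} (h : History n m) {u} → InWindow u c h → Uncovered h →
                 𝔼 c h (newlyCovered h₀) ≤ fromℕ c * q + cost u c h
        gain-≤ zero h (_ , _ , noRest) unc = ≤-trans (newlyCovered-≤0 h₀ h full₀ (noRest⇒coreOnly h noRest unc))
          (≤-reflexive (sym (trans (+-identityʳ _) (zeroˡ q))))
        gain-≤ (suc c) h {u} inW@(φ≡ , full , noRest) unc = begin
          Σ-subsets n (λ τ → slotProb h τ * G τ)
            ≈⟨ Σ-subsets-cong n (λ τ → *-congʳ (same τ)) ⟩
          Σ-subsets n (λ τ → bernoulli p τ * G τ)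
            ≤⟨ expectation-mono (coreProb-nonneg h) (coreProb-≤1 h) pointwise ⟩
          Σ-subsets n (λ τ → bernoulli p τ * (hit hvy u τ + (fromℕ c * q + cost u c (τ ∷ h))))
            ≈⟨ Σ-subsets-cong n (λ τ → trans (distribˡ _ _ _) (+-congˡ (distribˡ _ _ _))) ⟩
          Σ-subsets n (λ τ → bernoulli p τ * hit hvy u τ + (bernoulli p τ * (fromℕ c * q) + bernoulli p τ * cost u c (τ ∷ h)))
            ≈⟨ trans (Σ-subsets-+ n _ _) (+-congˡ (Σ-subsets-+ n _ _)) ⟩
          Σ-subsets n (λ τ → bernoulli p τ * hit hvy u τ) +
            (Σ-subsets n (λ τ → bernoulli p τ * (fromℕ c * q)) + F)
            ≤⟨ +-mono-≤ (Σ-hit-≤ h hvy u) (≤-reflexive (+-congʳ (expectation-const p (fromℕ c * q)))) ⟩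
          (q + lightCost hvy (p u)) + (fromℕ c * q + F)
            ≈⟨ solve 4 (λ q a c F → (q :+ a) :+ (c :* q :+ F) := (:1 :+ c) :* q :+ (a :+ F)) refl q (lightCost hvy (p u)) (fromℕ c) F ⟩
          fromℕ (suc c) * q + cost u (suc c) h ∎
          where
          open ≤-Reasoning
          hvy = heavy? h
          p = coreProb h
          G : Subset n → ℝ
          G τ = 𝔼 c (τ ∷ h) (newlyCovered h₀)
          F = Σ-subsets n (λ τ → bernoulli p τ * cost u c (τ ∷ h))
          coreOnly : CoreOnly h
          coreOnly = noRest⇒coreOnly h noRest unc
          same : ∀ τ → slotProb h τ ≈ bernoulli p τ
          same = bernoulli-cong (transmitProb≈coreProb h full coreOnly)
          0≤later : ∀ τ → 0# ≤ fromℕ c * q + cost u c (τ ∷ h)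
          0≤later τ = +-nonneg (*-nonneg (fromℕ-nonneg c) 0≤q) (cost-nonneg u c (τ ∷ h))
          pointwise : ∀ τ → ¬ (bernoulli p τ ≈ 0#) → G τ ≤ hit hvy u τ + (fromℕ c * q + cost u c (τ ∷ h))
          pointwise τ p≉0 = lem (true⊎false (cov (τ ∷ h) target))
            where
            sound : Sound h τ
            sound = slotProb≉0⇒sound h τ λ s≈0 → p≉0 (trans (sym (same τ)) s≈0)
            inW′ : InWindow u c (τ ∷ h)
            inW′ = inWindow-step h τ inW sound
            heard : cov h target ≡ true ⊎ Hears (mode h) τ target → 1# ≤ hit hvy u τ
            heard (inj₁ c)  = ⊥-elim (true≢false c unc)
            heard (inj₂ hr) = hears⇒1≤hit h hvy (≡.cong (modeOf h) φ≡) coreOnly sound hr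
            lem : cov (τ ∷ h) target ≡ true ⊎ cov (τ ∷ h) target ≡ false →
                  G τ ≤ hit hvy u τ + (fromℕ c * q + cost u c (τ ∷ h))
            -- If the target has just been covered, the crude bound 1 on the rest of the window is
            -- paid for by `hit`. If not, the induction hypothesis applies.
            lem (inj₁ c)    = ≤-trans (gain-≤1 _ (τ ∷ h) inW′)
              (≤-trans (heard (newly-covered-hears h τ target c)) (x≤x+y (0≤later τ)))
            lem (inj₂ unc′) = ≤-trans (gain-≤ c (τ ∷ h) inW′ unc′) (x≤y+x (hit-nonneg hvy u τ))

    -- From counting covered nodes to the core, and the conclusion.

    coreSet : Subset n
    coreSet = tabulate λ i → toℕ i ℕ.<ᵇ k

    ∣coreSet∣≡k : ∣ coreSet ∣ ≡ k
    ∣coreSet∣≡k = count n k (ℕₚ.<⇒≤ k<n)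
      where
      count : ∀ n k → k ℕ.≤ n → ∣ tabulate {n = n} (λ i → toℕ i ℕ.<ᵇ k) ∣ ≡ k
      count zero    zero    _           = ≡.refl
      count (suc n) zero    _           = count n zero ℕ.z≤n
      count (suc n) (suc k) (ℕ.s≤s k≤n) = ≡.cong suc (count n k k≤n)

    i<k⇒i∈coreSet : ∀ {i} → toℕ i ℕ.< k → i ∈ coreSet
    i<k⇒i∈coreSet {i} i<k = lookup⇒[]= i _ (≡.trans (lookup∘tabulate _ i) (lem (ℕₚ.<⇒<ᵇ i<k)))
      where
      lem : ∀ {b} → Truth b → b ≡ true
      lem {true} _ = ≡.refl

    i∈coreSet⇒i<k : ∀ {i} → i ∈ coreSet → toℕ i ℕ.< k
    i∈coreSet⇒i<k {i} i∈ = ℕₚ.<ᵇ⇒< (toℕ i) k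
      (≡.subst Truth (≡.sym (≡.trans (≡.sym (lookup∘tabulate _ i)) ([]=⇒lookup i∈))) _)

    full⇒k≤∣covered∣ : ∀ {m} (h : History n m) → Full h → k ℕ.≤ ∣ covered h ∣
    full⇒k≤∣covered∣ h full = ≡.subst (ℕ._≤ ∣ covered h ∣) ∣coreSet∣≡k
      (p⊆q⇒∣p∣≤∣q∣ λ {i} i∈ → cov⇒covered h (full i (i∈coreSet⇒i<k i∈)))

    coreOnly⇒∣covered∣≤k : ∀ {m} (h : History n m) → CoreOnly h → ∣ covered h ∣ ℕ.≤ k
    coreOnly⇒∣covered∣≤k h coreOnly = ≡.subst (∣ covered h ∣ ℕ.≤_) ∣coreSet∣≡k
      (p⊆q⇒∣p∣≤∣q∣ λ {i} i∈ → i<k⇒i∈coreSet (coreOnly i (covered⇒cov h i∈)))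

    -- A core node left out would make the covered set a proper subset of the core, hence smaller
    -- than `k`.
    k≤∣covered∣⇒full : ∀ {m} (h : History n m) → CoreOnly h → k ℕ.≤ ∣ covered h ∣ → Full h
    k≤∣covered∣⇒full h coreOnly k≤ i i<k = lem (true⊎false (cov h i))
      where
      lem : cov h i ≡ true ⊎ cov h i ≡ false → cov h i ≡ true
      lem (inj₁ c) = c
      lem (inj₂ c) = ⊥-elim (ℕₚ.<⇒≱ (≡.subst (∣ covered h ∣ ℕ.<_) ∣coreSet∣≡k
        (p⊂q⇒∣p∣<∣q∣ ((λ {j} j∈ → i<k⇒i∈coreSet (coreOnly j (covered⇒cov h j∈))) ,
                        i , i<k⇒i∈coreSet i<k , uncov⇒∉covered h c))) k≤)

    start-full : ∀ {m} (h : History n m) → Full h → start h ≡ window (proj₁ (cheap-node h)) β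
    start-full h full = lem em
      where
      lem : (d : Dec (Full h)) → startWith (proj₁ (cheap-node h)) d ≡ window (proj₁ (cheap-node h)) β
      lem (yes _)    = ≡.refl
      lem (no ¬full) = ⊥-elim (¬full full)

    -- The slot in which the count reaches `k` falls in the phase `spread`, since in a window the
    -- core is already covered. It stays within the core, so the count is exactly `k` and the window
    -- opens at the next slot.
    noProgress : ∀ {l D} → 0# ≤ l → 0# < D → exp l ≈ D → 2# * l ≤ θ →
                 fromℕ β * (2# * D ⁻¹) + fromℕ β * θ / fromℕ k < 1# → NoProgress k β
    noProgress {l} {D} 0≤l 0<D exp-l≈D 2l≤θ budget h τ (0<p , poss) few many =
      lem (phase h) ≡.refl (inv h poss)
      where
      g : History n _
      g = τ ∷ h
      u = proj₁ (cheap-node g)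
      lem : ∀ φ → phase h ≡ φ → Inv φ h →
            (∣ covered g ∣ ≡ k) × (𝔼 β g (newlyCovered g) < 1#)
      lem (window _ _) _ (full , _) = ⊥-elim (ℕₚ.<⇒≱ few (full⇒k≤∣covered∣ h full))
      lem spread φ≡ (_ , coreOnly) = ℕₚ.≤-antisym (coreOnly⇒∣covered∣≤k g coreOnly′) many ,
        ≤-<-trans (gain-≤ g full′ 0≤l 0<D exp-l≈D 2l≤θ β g inW unc) (≤-<-trans (+-monoʳ-≤ _ cost≤) budget)
        where
        coreOnly′ : CoreOnly g
        coreOnly′ = coreOnly-step h τ φ≡ coreOnly (slotProb≉0⇒sound h τ (pos⇒≉0 0<p))
        full′ : Full g
        full′ = k≤∣covered∣⇒full g coreOnly′ many
        inW : InWindow u β g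
        inW = ≡.trans (≡.cong (next g) φ≡) (start-full g full′) , full′ , λ i c → ℕₚ.<⇒≤ (coreOnly′ i c)
        unc : Uncovered g
        unc = uncovered (true⊎false (cov g target))
          where
          uncovered : cov g target ≡ true ⊎ cov g target ≡ false → cov g target ≡ false
          uncovered (inj₁ c) = ⊥-elim (ℕₚ.<-irrefl toℕ-target (coreOnly′ target c))
          uncovered (inj₂ c) = c
        cost≤ : cost u β g ≤ fromℕ β * θ / fromℕ k
        cost≤ = *-cancelˡ-≤ (fromℕ-pos 0<k)
          (≤-respʳ (sym (*-cancel-/ (fromℕ-pos 0<k))) (proj₂ (proj₂ (cheap-node g))))

theorem8 :
    (em : ExcludedMiddle 0ℓ) (ℛ : Reals) →
    let open Reals ℛ
        open Geocast em ℛ in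
    (n : ℕ) (P : Protocol n) (Vmax r d : ℝ) →
    0# < Vmax → 0# < r → r < d →
    (α β k : ℕ) → 0 ℕ.< β → 0 ℕ.< k →
    pow (fromℕ 2 / (1# - 1# / e)) (ξ / e) < fromℕ k → k ℕ.< n →
    Σ (MANET n Vmax) λ M →
    let open Execution P r d M in
    Connected α β ×
    AllTargets ×
    SimultaneousNoFailures ×
    (fromℕ β < fromℕ k / (fromℕ 2 * e * Γ β k) → NoProgress k β)
theorem8 em ℛ n P Vmax r d 0<Vmax 0<r r<d α β k 0<β 0<k large k<n =
  manet , connected 0<β α , allTargets , simultaneous ,
  -- The parameters are `l = ln δ` and `D = δ`; as `threshold` is defined as `2# * ln δ`, the
  -- condition on `θ` is reflexivity.
  λ short → noProgress (<⇒≤ (0<L 0<β 0<k large)) (0<δ 0<β 0<k large) (exp-ln (0<δ 0<β 0<k large)) ≤-refl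
    (window-budget<1 0<β 0<k large short)
  where
  open Reals ℛ using (exp-ln)
  open RealArithmetic ℛ using (<⇒≤; ≤-refl)
  open Threshold em ℛ β k
  open Adversary em ℛ n P r Vmax 0<r 0<Vmax β k 0<k k<n threshold (0≤threshold 0<β 0<k large)
  open Run d r<d
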